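{- Let $n,k$ be integers such that $k\geq 2$ and $n\geq 5k+2$, and let $G$ be a tripartite graph with parts $A,B,C$ such that $|A|=|B|=|C|=n$. Let $\tau_k(n)$ denote the positive solution of the equation $nx^2+(n+1-k)x-n=0$. If $d(G)>\tau_k(n)$, then $G$ contains $k$ vertex-disjoint triangles.
   Context: For a tripartite graph $G$ with parts $V_1,V_2,V_3$, $G[V_i,V_j]$ denotes the bipartite graph consisting of the edges of $G$ between $V_i$ and $V_j$, and the bipartite density of $G$ is $$d(G):=\min_{1\leq i<j\leq 3}\frac{|E(G[V_i,V_j])|}{|V_i|\cdot|V_j|}.$$ -}

module Defs where

open import Data.Fin using (Fin)
open import Data.Fin.Patterns using (0F; 1F; 2F)
open import Data.Integer using (+_)
open import Data.List using (List; allFin; cartesianProduct; filter; length)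
open import Data.Nat using (ℕ)
import Data.Nat as ℕ
import Data.Nat.Properties as ℕ
open import Data.Product using (Σ; ∃-syntax; _×_; _,_; proj₁)
open import Data.Rational
open import Data.Rational.Properties
open import Data.Rational.Solver using (module +-*-Solver)
open import Data.Sum using (_⊎_)
open import Level using (0ℓ)
open import Relation.Binary using (Rel; Decidable; Symmetric)
open import Relation.Binary.PropositionalEquality
open import Relation.Nullary using (¬_)
open +-*-Solver using (solve; _:+_; _:*_; _:-_; :-_; _:=_)

------------------------------------------------------------------------
-- Real numbers: Cauchy sequences of rationals, up to _≃ℝ_

record ℝ : Set where
  constructor mkℝ
  field
    seq    : ℕ → ℚ
    cauchy : ∀ ε → 0ℚ < ε →
             ∃[ N ] ∀ m n → N ℕ.≤ m → N ℕ.≤ n → ∣ seq m - seq n ∣ < ε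

open ℝ public

infix  4 _≃ℝ_ _<ℝ_
infixl 6 _+ℝ_ _-ℝ_
infixl 7 _*ℝ_
infix  8 -ℝ_

_≃ℝ_ : ℝ → ℝ → Set
x ≃ℝ y = ∀ ε → 0ℚ < ε → ∃[ N ] ∀ n → N ℕ.≤ n → ∣ seq x n - seq y n ∣ < ε

_<ℝ_ : ℝ → ℝ → Set
x <ℝ y = ∃[ ε ] 0ℚ < ε × ∃[ N ] ∀ n → N ℕ.≤ n → seq x n + ε < seq y n

fromℚ : ℚ → ℝ
fromℚ p = mkℝ (λ _ → p) λ ε 0<ε → 0 , λ _ _ _ _ →
  subst (λ q → ∣ q ∣ < ε) (sym (+-inverseʳ p)) 0<ε

fromℕ : ℕ → ℝ
fromℕ n = fromℚ (+ n / 1)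

0ℝ 1ℝ : ℝ
0ℝ = fromℚ 0ℚ
1ℝ = fromℚ 1ℚ

-ℝ_ : ℝ → ℝ
-ℝ x = mkℝ (λ n → - seq x n) λ ε 0<ε →
  let N , close = cauchy x ε 0<ε in
  N , λ m n N≤m N≤n → subst (_< ε) (eq (seq x m) (seq x n)) (close m n N≤m N≤n)
  where
  eq : ∀ p q → ∣ p - q ∣ ≡ ∣ - p - - q ∣
  eq p q = trans (sym (∣-p∣≡∣p∣ (p - q)))
    (cong ∣_∣ (solve 2 (λ a b → :- (a :- b) := :- a :- :- b) refl p q))

_+ℝ_ : ℝ → ℝ → ℝ
x +ℝ y = mkℝ (λ n → seq x n + seq y n) λ ε 0<ε →
  let instance _ = positive 0<ε
      δ   = ½ * ε
      0<δ = positive⁻¹ δ {{pos*pos⇒pos ½ ε}}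
      M , closeˣ = cauchy x δ 0<δ
      N , closeʸ = cauchy y δ 0<δ
  in M ℕ.⊔ N , λ m n l l′ → bound (seq x m) (seq y m) (seq x n) (seq y n)
       (closeˣ m n (ℕ.m⊔n≤o⇒m≤o M N l) (ℕ.m⊔n≤o⇒m≤o M N l′))
       (closeʸ m n (ℕ.m⊔n≤o⇒n≤o M N l) (ℕ.m⊔n≤o⇒n≤o M N l′))
  where
  open ≤-Reasoning
  bound : ∀ {ε} a b c d → ∣ a - c ∣ < ½ * ε → ∣ b - d ∣ < ½ * ε →
          ∣ (a + b) - (c + d) ∣ < ε
  bound {ε} a b c d p q = begin-strict
    ∣ (a + b) - (c + d) ∣      ≡⟨ cong ∣_∣ (solve 4 (λ a b c d →
                                    (a :+ b) :- (c :+ d) := (a :- c) :+ (b :- d))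
                                    refl a b c d) ⟩
    ∣ (a - c) + (b - d) ∣      ≤⟨ ∣p+q∣≤∣p∣+∣q∣ (a - c) (b - d) ⟩
    ∣ a - c ∣ + ∣ b - d ∣      <⟨ +-mono-< p q ⟩
    ½ * ε + ½ * ε              ≡⟨ *-distribʳ-+ ε ½ ½ ⟨
    1ℚ * ε                     ≡⟨ *-identityˡ ε ⟩
    ε                          ∎

_-ℝ_ : ℝ → ℝ → ℝ
x -ℝ y = x +ℝ (-ℝ y)

eventuallyBounded : (x : ℝ) →
  ∃[ B ] Positive B × ∃[ N ] ∀ n → N ℕ.≤ n → ∣ seq x n ∣ ≤ B
eventuallyBounded x =
  let N , close = cauchy x 1ℚ (positive⁻¹ 1ℚ)
      c = seq x N
  in (∣ c ∣ + 1ℚ)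
   , nonNeg+pos⇒pos (∣ c ∣) {{∣-∣-nonNeg c}} 1ℚ
   , N
   , λ n N≤n → bound (seq x n) c (close n N N≤n ℕ.≤-refl)
  where
  open ≤-Reasoning
  bound : ∀ a c → ∣ a - c ∣ < 1ℚ → ∣ a ∣ ≤ ∣ c ∣ + 1ℚ
  bound a c p = begin
    ∣ a ∣             ≡⟨ cong ∣_∣ (solve 2 (λ a c → a := c :+ (a :- c)) refl a c) ⟩
    ∣ c + (a - c) ∣   ≤⟨ ∣p+q∣≤∣p∣+∣q∣ c (a - c) ⟩
    ∣ c ∣ + ∣ a - c ∣ ≤⟨ +-monoʳ-≤ (∣ c ∣) (<⇒≤ p) ⟩
    ∣ c ∣ + 1ℚ        ∎

_*ℝ_ : ℝ → ℝ → ℝ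
x *ℝ y = mkℝ (λ n → seq x n * seq y n) λ ε 0<ε →
  let X , X>0 , M₁ , boundˣ = eventuallyBounded x
      Y , Y>0 , M₂ , boundʸ = eventuallyBounded y
      S   = X + Y
      S>0 = pos+pos⇒pos X {{X>0}} Y {{Y>0}}
      S≢0 = pos⇒nonZero S {{S>0}}
      δ   = ε * (1/ S) {{S≢0}}
      0<δ = positive⁻¹ δ
              {{pos*pos⇒pos ε {{positive 0<ε}} ((1/ S) {{S≢0}}) {{1/pos⇒pos S {{S>0}}}}}}
      N₁ , closeˣ = cauchy x δ 0<δ
      N₂ , closeʸ = cauchy y δ 0<δ
      δS≡ε = trans (*-assoc ε ((1/ S) {{S≢0}}) S)
               (trans (cong (ε *_) (*-inverseˡ S {{S≢0}})) (*-identityʳ ε))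
      M = M₁ ℕ.⊔ M₂
      N = N₁ ℕ.⊔ N₂
  in M ℕ.⊔ N , λ m n l l′ →
       let M≤m = ℕ.m⊔n≤o⇒m≤o M N l
           M≤n = ℕ.m⊔n≤o⇒m≤o M N l′
           N≤m = ℕ.m⊔n≤o⇒n≤o M N l
           N≤n = ℕ.m⊔n≤o⇒n≤o M N l′
       in subst (∣ seq x m * seq y m - seq x n * seq y n ∣ <_) δS≡ε
            (estimate X>0 Y>0 (seq x m) (seq y m) (seq x n) (seq y n)
              (boundˣ m (ℕ.m⊔n≤o⇒m≤o M₁ M₂ M≤m))
              (boundʸ n (ℕ.m⊔n≤o⇒n≤o M₁ M₂ M≤n))
              (closeˣ m n (ℕ.m⊔n≤o⇒m≤o N₁ N₂ N≤m) (ℕ.m⊔n≤o⇒m≤o N₁ N₂ N≤n))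
              (closeʸ m n (ℕ.m⊔n≤o⇒n≤o N₁ N₂ N≤m) (ℕ.m⊔n≤o⇒n≤o N₁ N₂ N≤n)))
  where
  open ≤-Reasoning
  estimate : ∀ {X Y δ} → Positive X → Positive Y → ∀ a b c d →
             ∣ a ∣ ≤ X → ∣ d ∣ ≤ Y → ∣ a - c ∣ < δ → ∣ b - d ∣ < δ →
             ∣ a * b - c * d ∣ < δ * (X + Y)
  estimate {X} {Y} {δ} X>0 Y>0 a b c d a≤X d≤Y p q = begin-strict
    ∣ a * b - c * d ∣                     ≡⟨ cong ∣_∣ (solve 4 (λ a b c d →
                                               a :* b :- c :* d :=
                                               a :* (b :- d) :+ d :* (a :- c))
                                               refl a b c d) ⟩
    ∣ a * (b - d) + d * (a - c) ∣         ≤⟨ ∣p+q∣≤∣p∣+∣q∣ (a * (b - d)) (d * (a - c)) ⟩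
    ∣ a * (b - d) ∣ + ∣ d * (a - c) ∣     ≡⟨ cong₂ _+_ (∣p*q∣≡∣p∣*∣q∣ a (b - d))
                                                       (∣p*q∣≡∣p∣*∣q∣ d (a - c)) ⟩
    ∣ a ∣ * ∣ b - d ∣ + ∣ d ∣ * ∣ a - c ∣ ≤⟨ +-mono-≤
                                               (*-monoʳ-≤-nonNeg (∣ b - d ∣) {{∣-∣-nonNeg (b - d)}} a≤X)
                                               (*-monoʳ-≤-nonNeg (∣ a - c ∣) {{∣-∣-nonNeg (a - c)}} d≤Y) ⟩
    X * ∣ b - d ∣ + Y * ∣ a - c ∣         <⟨ +-mono-< (*-monoʳ-<-pos X {{X>0}} q)
                                                      (*-monoʳ-<-pos Y {{Y>0}} p) ⟩
    X * δ + Y * δ                         ≡⟨ solve 3 (λ X Y δ →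
                                               X :* δ :+ Y :* δ := δ :* (X :+ Y))
                                               refl X Y δ ⟩
    δ * (X + Y)                           ∎

-- τ is the positive solution of n x² + (n + 1 - k) x - n = 0; the subtractions
-- are those of ℝ, not truncated.  For n > 0 the product of the two roots is -1,
-- so exactly one root is positive.
Isτ : (k n : ℕ) → ℝ → Set
Isτ k n τ =
  0ℝ <ℝ τ ×
  fromℕ n *ℝ (τ *ℝ τ) +ℝ (fromℕ n +ℝ 1ℝ -ℝ fromℕ k) *ℝ τ -ℝ fromℕ n ≃ℝ 0ℝ

------------------------------------------------------------------------
-- Finite simple tripartite graphs; part i has `size i` vertices

-- Loops are excluded by `tripartite`.
record TripartiteGraph (size : Fin 3 → ℕ) : Set₁ where
  Vertex : Set
  Vertex = Σ (Fin 3) λ i → Fin (size i)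

  field
    Adj        : Rel Vertex 0ℓ
    adj?       : Decidable Adj
    symmetric  : Symmetric Adj
    tripartite : ∀ {u v} → Adj u v → proj₁ u ≢ proj₁ v

module _ {size : Fin 3 → ℕ} (G : TripartiteGraph size) where
  open TripartiteGraph G

  -- For i ≢ j each edge {u , v} between the two parts is listed exactly once.
  edges : (i j : Fin 3) → List (Fin (size i) × Fin (size j))
  edges i j = filter (λ (u , v) → adj? (i , u) (j , v))
                     (cartesianProduct (allFin (size i)) (allFin (size j)))

  pairDensity : (i j : Fin 3) →
                .{{ℕ.NonZero (size i)}} → .{{ℕ.NonZero (size j)}} → ℚ
  pairDensity i j =
    (+ length (edges i j) / (size i ℕ.* size j)) {{ℕ.m*n≢0 (size i) (size j)}}

  density : .{{∀ {i} → ℕ.NonZero (size i)}} → ℚ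
  density = pairDensity 0F 1F ⊓ pairDensity 0F 2F ⊓ pairDensity 1F 2F

  record Triangle : Set where
    field
      {a b c} : Vertex
      ab      : Adj a b
      bc      : Adj b c
      ac      : Adj a c

  _∈△_ : Vertex → Triangle → Set
  v ∈△ T = v ≡ a ⊎ v ≡ b ⊎ v ≡ c
    where open Triangle T

  HasDisjointTriangles : ℕ → Set
  HasDisjointTriangles k =
    Σ (Fin k → Triangle) λ T →
      ∀ s t → s ≢ t → ∀ v → v ∈△ T s → ¬ (v ∈△ T t)

5k+2≤n⇒nonZero : ∀ k {n} → 5 ℕ.* k ℕ.+ 2 ℕ.≤ n → ℕ.NonZero n
5k+2≤n⇒nonZero k le = ℕ.>-nonZero (ℕ.<-≤-trans ℕ.0<1+n (ℕ.m+n≤o⇒n≤o (5 ℕ.* k) le))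

{-# OPTIONS --safe #-}

-- Let K = k - 1.  By induction on m, G has m + 1 disjoint triangles avoiding S for every set S of
-- at most K - m vertices.  Otherwise a packing P of m triangles avoiding S is maximal, and by
-- induction every vertex v has a packing of m triangles avoiding S and v, which then meets every
-- triangle through v.  By maximality, for each T in P the triangles meeting P in a single
-- vertex, lying on T, either all use the same vertex of T, or all pass through one common vertex
-- outside of P.  Hence deleting at most (10m² + 6m)/3 edges leaves a triangle-free graph on the
-- complement of S, and the density of G is large enough for this graph to violate a theorem of
-- Bondy, Shen, Thomassé and Thomassé: in a triangle-free tripartite graph with densities
-- α, β, γ, one of αβ + γ > 1, αγ + β > 1, βγ + α > 1 fails.  The latter is shown by comparing,
-- over pairs of vertices of A, how far their degrees to B and to C deviate from the average.

module Submission where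

open import Algebra.Properties.CommutativeSemigroup using (interchange)
open import Data.Bool using (Bool; true; false; _∧_; _∨_; not)
import Data.Bool.Properties as Bool
open import Data.Bool.Properties using (∨-conicalˡ; ∨-conicalʳ; ∨-zeroʳ)
open import Data.Empty using (⊥; ⊥-elim)
open import Data.Fin using (Fin; zero; suc; fromℕ<)
open import Data.Fin.Patterns using (0F; 1F; 2F)
import Data.Fin.Properties as Fin
open import Data.Integer as ℤ using (0ℤ; +≤+; +<+)
import Data.Integer.Properties as ℤ
open import Data.Integer.Tactic.RingSolver using (solve-∀)
open import Data.List using (List; []; _∷_; _++_; length; map; filter; filterᵇ; allFin; cartesianProduct)
open import Data.List.Membership.Propositional using (_∈_)
open import Data.List.Membership.Propositional.Properties using (∈-allFin)
open import Data.List.Properties using (length-++; length-tabulate; filter-++)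
open import Data.List.Relation.Unary.All using (All; []; _∷_)
open import Data.List.Relation.Unary.AllPairs using ([]; _∷_)
open import Data.List.Relation.Unary.Any using (here; there)
open import Data.List.Relation.Unary.Unique.Propositional using (Unique)
open import Data.List.Relation.Unary.Unique.Propositional.Properties using (allFin⁺)
open import Data.Nat as ℕ using (ℕ; zero; suc; z≤n; s≤s)
import Data.Nat.Properties as ℕ
open import Data.Product using (∃; ∃-syntax; _×_; _,_; proj₁; proj₂)
import Data.Rational as ℚ
import Data.Rational.Properties as ℚ
open import Data.Rational.Solver using (module +-*-Solver)
import Data.Rational.Unnormalised as ℚᵘ
import Data.Rational.Unnormalised.Properties as ℚᵘ
open import Data.Sum using (_⊎_; inj₁; inj₂)
open import Function using (id; _∘_)
open import Relation.Binary.PropositionalEquality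
open import Relation.Nullary using (¬_; yes; no; does; Dec; ¬?; _×-dec_; _→-dec_; _⊎-dec_)
open import Relation.Nullary.Decidable
  using (dec-true; dec-false; map′; from-yes; decidable-stable)

open import Defs

-- Let e be a common lower bound on the three edge counts. With x = e/n² the root condition,
-- multiplied by n³, becomes e² + n(n - K)e > n⁴. Bounding α and β below linearly in the numbers of
-- vertices of S turns αβ + γ > 1 on the complement of S into the same expression with |S| in place
-- of K, up to a nonnegative term. As |S| ≤ K - m, a surplus of nem remains, and it has to pay n²
-- for every deleted edge. So em ≥ n(10m² + 6m)/3 is enough, and this follows from 3e ≥ n(10K + 6)
-- because m ≤ K. That last inequality is what n ≥ 5k + 2 = 5K + 7 buys: the threshold for n/K lies
-- slightly below 5. The inequalities are cleared of denominators and proved over the integers,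
-- mostly by writing a difference as a sum of products of known sign.

-- Polynomial inequalities behind the triangle-free density theorem

module IntegerInequalities where
  open import Data.Integer using (+_; _+_; _*_; _-_; _≤_; _<_)

  0≤* : ∀ {i j} → 0ℤ ≤ i → 0ℤ ≤ j → 0ℤ ≤ i * j
  0≤* {+ m} {+ n} _ _ = subst (0ℤ ≤_) (ℤ.pos-* m n) (+≤+ z≤n)

  0<* : ∀ {i j} → 0ℤ < i → 0ℤ < j → 0ℤ < i * j
  0<* {+ suc m} {+ suc n} _ _ = +<+ (s≤s z≤n)
  0<* {+ zero} (+<+ ()) _
  0<* {+ suc m} {+ zero} _ (+<+ ())

  0≤+ : ∀ {i j} → 0ℤ ≤ i → 0ℤ ≤ j → 0ℤ ≤ i + j
  0≤+ = ℤ.+-mono-≤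

  0<+≤ : ∀ {i j} → 0ℤ < i → 0ℤ ≤ j → 0ℤ < i + j
  0<+≤ = ℤ.+-mono-<-≤

  0≤-by : ∀ {i j} → 0ℤ ≤ i → i ≡ j → 0ℤ ≤ j
  0≤-by p eq = subst (0ℤ ≤_) eq p

  0<-by : ∀ {i j} → 0ℤ < i → i ≡ j → 0ℤ < j
  0<-by p eq = subst (0ℤ <_) eq p

  0<⇒0≤ : ∀ {i} → 0ℤ < i → 0ℤ ≤ i
  0<⇒0≤ = ℤ.<⇒≤

  0<-cancel : ∀ {i j} → 0ℤ < i → 0ℤ < i * j → 0ℤ < j
  0<-cancel {i} {j} 0<i p =
    ℤ.*-cancelˡ-<-nonNeg i {{ℤ.nonNegative (0<⇒0≤ 0<i)}} (subst (_< i * j) (sym (ℤ.*-zeroʳ i)) p)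

  -- The usual way to use a strict inequality `0ℤ < i` below: exhibit the negative of `i` as a
  -- manifestly nonnegative expression `j`, and let the ring solver check that they cancel.
  absurd : ∀ {i j} → 0ℤ < i → 0ℤ ≤ j → i + j ≡ 0ℤ → ⊥
  absurd p q eq = ℤ.<-irrefl (sym eq) (0<+≤ p q)

  -- (Y + v)(XY - (Q - X)v) is concave in v, and the last two hypotheses are its values
  -- at v = 0 and v = S - Y compared with Yμ.
  concave : ∀ X Y Q S μ v k → 0ℤ < Y → 0ℤ ≤ v → 0ℤ ≤ S - Y - v → 0ℤ ≤ Q - X →
    0ℤ ≤ (Q - X) * v - k → 0ℤ < X * Y - μ → 0ℤ < Y * (Q * S - μ) - S * S * (Q - X) →
    0ℤ < (Y + v) * (X * Y - k) - Y * μ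
  concave X Y Q S μ v k 0<Y 0≤v v≤ 0≤U k≤ hA hC =
    0<-by (0<+≤ base (0≤* (0≤+ (0<⇒0≤ 0<Y) 0≤v) k≤)) (e₀ X Y Q μ v k)
    where
    e₀ : ∀ X Y Q μ v k → (Y + v) * (X * Y - (Q - X) * v) - Y * μ + (Y + v) * ((Q - X) * v - k)
         ≡ (Y + v) * (X * Y - k) - Y * μ
    e₀ = solve-∀
    -- Interpolation between the two endpoints with weights `v` and `S - Y - v`; the last product is
    -- the concavity gap.
    e₁ : ∀ X Y Q S μ v →
         v * (Y * (Q * S - μ) - S * S * (Q - X)) +
         ((S - Y - v) * (Y * (X * Y - μ)) + (Q - X) * v * (S - Y) * (S - Y - v))
         ≡ (S - Y) * ((Y + v) * (X * Y - (Q - X) * v) - Y * μ)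
    e₁ = solve-∀
    e₂ : ∀ S Y v → v + (S - Y - v) ≡ S - Y
    e₂ = solve-∀
    e₃ : ∀ X Y Q μ → Y * (X * Y - μ) ≡ (Y + 0ℤ) * (X * Y - (Q - X) * 0ℤ) - Y * μ
    e₃ = solve-∀
    base : 0ℤ < (Y + v) * (X * Y - (Q - X) * v) - Y * μ
    base with v ℤ.≟ 0ℤ
    -- Treated apart because for `v = 0` the interval may be a point, and then `S - Y` cannot be
    -- cancelled.
    ... | yes refl = 0<-by (0<* 0<Y hA) (e₃ X Y Q μ)
    ... | no v≢0 = 0<-cancel 0<V (0<-by (0<+≤ (0<* 0<v hC)
        (0≤+ (0≤* v≤ (0≤* (0<⇒0≤ 0<Y) (0<⇒0≤ hA)))
             (0≤* (0≤* (0≤* 0≤U 0≤v) (0<⇒0≤ 0<V)) v≤))) (e₁ X Y Q S μ v))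
      where
      0<v : 0ℤ < v
      0<v = ℤ.≤∧≢⇒< 0≤v λ eq → v≢0 (sym eq)
      0<V : 0ℤ < S - Y
      0<V = 0<-by (0<+≤ 0<v v≤) (e₂ S Y v)

  -- By `concave` at v = v₂, the number (Y + v₂)(XY - u₁v₂) exceeds Y times the bracket subtracted
  -- from `μ`. The difference equals v₂(Yu₂ - u₁v₂) minus nonnegative terms, and its product with v₁
  -- equals (Y - v₁)u₁(v₂² - Yv₁) minus nonnegative terms. Both use u₁v₂ ≥ u₂v₁.
  side : ∀ X Y Q S μ u₁ u₂ v₁ v₂ →
    0ℤ ≤ u₁ → 0ℤ ≤ v₂ → 0ℤ < v₁ → 0ℤ ≤ Y - v₁ →
    0ℤ ≤ Q - X - u₁ → 0ℤ ≤ S - Y - v₂ →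
    0ℤ < X * Y - μ → 0ℤ < Y * (Q * S - μ) - S * S * (Q - X) →
    0ℤ ≤ μ - (X * Y + Y * u₁ + X * v₂ - u₁ * v₁ - u₂ * v₂ - u₂ * v₁) →
    0ℤ ≤ u₁ * v₂ - u₂ * v₁ →
    0ℤ < Y * u₂ - u₁ * v₂ × 0ℤ < v₂ * v₂ - Y * v₁
  side X Y Q S μ u₁ u₂ v₁ v₂ 0≤u₁ 0≤v₂ 0<v₁ v₁≤Y u₁≤ v₂≤ hA hC hF hk =
    first , second
    where
    e₁ : ∀ Y v₁ → v₁ + (Y - v₁) ≡ Y
    e₁ = solve-∀
    0<Y : 0ℤ < Y
    0<Y = 0<-by (0<+≤ 0<v₁ v₁≤Y) (e₁ Y v₁)
    0≤U : 0ℤ ≤ Q - X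
    0≤U = 0≤-by (0≤+ 0≤u₁ u₁≤) (e (Q - X) u₁)
      where
      e : ∀ a b → b + (a - b) ≡ a
      e = solve-∀
    D<0 : 0ℤ < (Y + v₂) * (X * Y - u₁ * v₂)
               - Y * (X * Y + Y * u₁ + X * v₂ - u₁ * v₁ - u₂ * v₂ - u₂ * v₁)
    D<0 = 0<-by (0<+≤ (concave X Y Q S μ v₂ (u₁ * v₂) 0<Y 0≤v₂ v₂≤ 0≤U
                         (0≤-by (0≤* u₁≤ 0≤v₂) (e (Q - X) u₁ v₂)) hA hC)
                      (0≤* (0<⇒0≤ 0<Y) hF))
                (e′ ((Y + v₂) * (X * Y - u₁ * v₂)) Y μ _)
      where
      e : ∀ a b c → (a - b) * c ≡ a * c - b * c
      e = solve-∀
      e′ : ∀ a Y μ F → a - Y * μ + Y * (μ - F) ≡ a - Y * F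
      e′ = solve-∀
    first : 0ℤ < Y * u₂ - u₁ * v₂
    first = ℤ.≰⇒> λ le → absurd D<0
      (0≤+ (0≤+ (0≤* (0≤* (0<⇒0≤ 0<Y) 0≤u₁) v₁≤Y) (0≤* (0<⇒0≤ 0<Y) hk))
           (0≤* 0≤v₂ (ℤ.neg-mono-≤ le)))
      (eq X Y u₁ u₂ v₁ v₂)
      where
      eq : ∀ X Y u₁ u₂ v₁ v₂ →
        (Y + v₂) * (X * Y - u₁ * v₂)
          - Y * (X * Y + Y * u₁ + X * v₂ - u₁ * v₁ - u₂ * v₂ - u₂ * v₁)
        + (Y * u₁ * (Y - v₁) + Y * (u₁ * v₂ - u₂ * v₁) + v₂ * ℤ.- (Y * u₂ - u₁ * v₂)) ≡ 0ℤ
      eq = solve-∀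
    second : 0ℤ < v₂ * v₂ - Y * v₁
    second = ℤ.≰⇒> λ le → absurd (0<* 0<v₁ D<0)
      (0≤+ (0≤* (0≤* v₁≤Y 0≤u₁) (ℤ.neg-mono-≤ le))
           (0≤* (0≤* (0<⇒0≤ 0<Y) (0≤+ (0<⇒0≤ 0<v₁) 0≤v₂)) hk))
      (eq X Y u₁ u₂ v₁ v₂)
      where
      eq : ∀ X Y u₁ u₂ v₁ v₂ →
        v₁ * ((Y + v₂) * (X * Y - u₁ * v₂)
          - Y * (X * Y + Y * u₁ + X * v₂ - u₁ * v₁ - u₂ * v₂ - u₂ * v₁))
        + ((Y - v₁) * u₁ * ℤ.- (v₂ * v₂ - Y * v₁)
           + Y * (v₁ + v₂) * (u₁ * v₂ - u₂ * v₁)) ≡ 0ℤ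
      eq = solve-∀

  -- u₁, v₂ are excesses and u₂, v₁ deficits of (scaled) degrees.  If u₁v₂ ≥ u₂v₁, then `side`
  -- and its mirror image give (u₁v₂)² < (Yu₂)(Xv₁) and (Yv₁)(Xu₂) < (v₂u₁)², a contradiction.
  deviations : ∀ X Y Q S μ u₁ u₂ v₁ v₂ →
    0ℤ ≤ u₁ → 0ℤ < u₂ → 0ℤ < v₁ → 0ℤ ≤ v₂ → 0ℤ ≤ X - u₂ → 0ℤ ≤ Y - v₁ →
    0ℤ ≤ Q - X - u₁ → 0ℤ ≤ S - Y - v₂ →
    0ℤ < X * Y - μ →
    0ℤ < X * (Q * S - μ) - Q * Q * (S - Y) →
    0ℤ < Y * (Q * S - μ) - S * S * (Q - X) →
    0ℤ ≤ μ - (X * Y + Y * u₁ + X * v₂ - u₁ * v₁ - u₂ * v₂ - u₂ * v₁) →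
    u₁ * v₂ < u₂ * v₁
  deviations X Y Q S μ u₁ u₂ v₁ v₂ 0≤u₁ 0<u₂ 0<v₁ 0≤v₂ u₂≤X v₁≤Y u₁≤ v₂≤ hA hB hC hF =
    ℤ.≰⇒> λ le →
      let hk = ℤ.i≤j⇒0≤j-i le
          k<Yu₂ , Yv₁<v₂² = side X Y Q S μ u₁ u₂ v₁ v₂ 0≤u₁ 0≤v₂ 0<v₁ v₁≤Y u₁≤ v₂≤ hA hC hF hk
          k<Xv₁ , Xu₂<u₁² = side Y X S Q μ v₂ v₁ u₂ u₁ 0≤v₂ 0≤u₁ 0<u₂ u₂≤X v₂≤ u₁≤
            (0<-by hA (cong (_- μ) (ℤ.*-comm X Y)))
            (subst (λ z → 0ℤ < X * (z - μ) - Q * Q * (S - Y)) (ℤ.*-comm Q S) hB)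
            (0≤-by hF (cong (ℤ._-_ μ) (e₁ X Y u₁ u₂ v₁ v₂)))
            (0≤-by hk (e₂ u₁ u₂ v₁ v₂))
          k≥0 = 0≤* 0≤u₁ 0≤v₂
          0<X = 0<-by (0<+≤ 0<u₂ u₂≤X) (e₃ X u₂)
          0<Y = 0<-by (0<+≤ 0<v₁ v₁≤Y) (e₃ Y v₁)
      in absurd
        (0<+≤ (0<* Yv₁<v₂² (0<-by (0<+≤ Xu₂<u₁² (0≤* (0<⇒0≤ 0<X) (0<⇒0≤ 0<u₂))) (e₄ X u₁ u₂)))
              (0≤* (0≤* (0<⇒0≤ 0<Y) (0<⇒0≤ 0<v₁)) (0<⇒0≤ Xu₂<u₁²)))
        (0≤+ (0≤* (0<⇒0≤ k<Yu₂) (0≤* (0<⇒0≤ 0<X) (0<⇒0≤ 0<v₁)))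
             (0≤* k≥0 (0<⇒0≤ (0<-by k<Xv₁ (cong (X * v₁ -_) (ℤ.*-comm v₂ u₁))))))
        (e₅ X Y u₁ u₂ v₁ v₂)
    where
    e₁ : ∀ X Y u₁ u₂ v₁ v₂ → X * Y + Y * u₁ + X * v₂ - u₁ * v₁ - u₂ * v₂ - u₂ * v₁
         ≡ Y * X + X * v₂ + Y * u₁ - v₂ * u₂ - v₁ * u₁ - v₁ * u₂
    e₁ = solve-∀
    e₂ : ∀ u₁ u₂ v₁ v₂ → u₁ * v₂ - u₂ * v₁ ≡ v₂ * u₁ - v₁ * u₂
    e₂ = solve-∀
    e₃ : ∀ X u → u + (X - u) ≡ X
    e₃ = solve-∀
    e₄ : ∀ X u₁ u₂ → u₁ * u₁ - X * u₂ + X * u₂ ≡ u₁ * u₁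
    e₄ = solve-∀
    e₅ : ∀ X Y u₁ u₂ v₁ v₂ →
      (v₂ * v₂ - Y * v₁) * (u₁ * u₁) + Y * v₁ * (u₁ * u₁ - X * u₂)
      + ((Y * u₂ - u₁ * v₂) * (X * v₁) + u₁ * v₂ * (X * v₁ - u₁ * v₂)) ≡ 0ℤ
    e₅ = solve-∀

  -- `deviations` for degrees scaled by `p`, with Q = pq, S = pw and μ = p²(qw - Z). For the
  -- densities α = X/pq, β = Y/pw, γ = Z/qw, the three strict polynomial hypotheses are αβ + γ > 1,
  -- αγ + β > 1 and βγ + α > 1, cleared of denominators.
  degree-deviations : ∀ p q w X Y Z x₁ x₂ y₁ y₂ →
    0ℤ < p → 0ℤ ≤ X → 0ℤ ≤ Y → 0ℤ ≤ x₂ → 0ℤ ≤ y₁ → 0ℤ ≤ y₂ → 0ℤ ≤ q - x₁ → 0ℤ ≤ w - y₂ →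
    0ℤ ≤ q * w + x₁ * y₁ - (x₁ * y₁ + x₁ * y₁ + Z) →
    0ℤ ≤ q * w + x₂ * y₂ - (x₂ * y₂ + x₂ * y₂ + Z) →
    0ℤ ≤ q * w + x₂ * y₁ - (x₁ * y₁ + x₂ * y₂ + Z) →
    0ℤ < X * Y - p * p * (q * w - Z) →
    0ℤ < X * Z - q * q * (p * w - Y) →
    0ℤ < Y * Z - w * w * (p * q - X) →
    0ℤ ≤ p * x₁ - X → 0ℤ ≤ p * y₂ - Y →
    0ℤ < X - p * x₂ × 0ℤ < Y - p * y₁ ×
    (p * x₁ - X) * (p * y₂ - Y) < (X - p * x₂) * (Y - p * y₁)
  degree-deviations p q w X Y Z x₁ x₂ y₁ y₂ 0<p 0≤X 0≤Y 0≤x₂ 0≤y₁ 0≤y₂ x₁≤q y₂≤w h₁₁ h₂₂ h₁₂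
    hA hB hC x₁≥ y₂≥ =
    below 0≤y₂ h₂₂ y₂≥ , below′ 0≤y₁ h₁₁ x₁≥ ,
    deviations X Y (p * q) (p * w) (p * p * (q * w - Z))
      (p * x₁ - X) (X - p * x₂) (Y - p * y₁) (p * y₂ - Y)
      x₁≥ (below 0≤y₂ h₂₂ y₂≥) (below′ 0≤y₁ h₁₁ x₁≥) y₂≥
      (0≤-by (0≤* 0≤p 0≤x₂) (sub X (p * x₂))) (0≤-by (0≤* 0≤p 0≤y₁) (sub Y (p * y₁)))
      (0≤-by (0≤* 0≤p x₁≤q) (top p q X x₁)) (0≤-by (0≤* 0≤p y₂≤w) (top p w Y y₂))
      hA
      (0<-by (0<* (0<* 0<p 0<p) hB) (eB p q w X Y Z))
      (0<-by (0<* (0<* 0<p 0<p) hC) (eC p q w X Y Z))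
      (0≤-by (0≤* (0≤* 0≤p 0≤p) h₁₂) (eF p q w X Y Z x₁ x₂ y₁ y₂))
    where
    0≤p : 0ℤ ≤ p
    0≤p = 0<⇒0≤ 0<p
    sub : ∀ a b → b ≡ a - (a - b)
    sub = solve-∀
    top : ∀ p q X x → p * (q - x) ≡ p * q - X - (p * x - X)
    top = solve-∀
    eB : ∀ p q w X Y Z → p * p * (X * Z - q * q * (p * w - Y))
      ≡ X * (p * q * (p * w) - p * p * (q * w - Z)) - p * q * (p * q) * (p * w - Y)
    eB = solve-∀
    eC : ∀ p q w X Y Z → p * p * (Y * Z - w * w * (p * q - X))
      ≡ Y * (p * q * (p * w) - p * p * (q * w - Z)) - p * w * (p * w) * (p * q - X)
    eC = solve-∀
    eF : ∀ p q w X Y Z x₁ x₂ y₁ y₂ →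
      p * p * (q * w + x₂ * y₁ - (x₁ * y₁ + x₂ * y₂ + Z))
      ≡ p * p * (q * w - Z) - (X * Y + Y * (p * x₁ - X) + X * (p * y₂ - Y)
          - (p * x₁ - X) * (Y - p * y₁) - (X - p * x₂) * (p * y₂ - Y) - (X - p * x₂) * (Y - p * y₁))
    eF = solve-∀
    eN : ∀ p q w X Y Z x y → X * Y - p * p * (q * w - Z)
      + (X * (p * y - Y) + (p * x - X) * (p * y) + p * p * (q * w + x * y - (x * y + x * y + Z)))
      ≡ 0ℤ
    eN = solve-∀
    neg : ∀ a b → ℤ.- (a - b) ≡ b - a
    neg = solve-∀
    -- A vertex with at least average degree on both sides would satisfy p²xy ≥ XY > p²(qw - Z),
    -- whereas the xy pairs between its two neighbourhoods are all nonadjacent. So an excess towards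
    -- one side forces a strict deficit towards the other.
    not-both : ∀ {x y} → 0ℤ ≤ y → 0ℤ ≤ q * w + x * y - (x * y + x * y + Z) →
      0ℤ ≤ p * x - X → 0ℤ ≤ p * y - Y → ⊥
    not-both {x} {y} 0≤y h x≥ y≥ = absurd hA
      (0≤+ (0≤+ (0≤* 0≤X y≥) (0≤* x≥ (0≤* 0≤p 0≤y))) (0≤* (0≤* 0≤p 0≤p) h))
      (eN p q w X Y Z x y)
    below : ∀ {x y} → 0ℤ ≤ y → 0ℤ ≤ q * w + x * y - (x * y + x * y + Z) →
      0ℤ ≤ p * y - Y → 0ℤ < X - p * x
    below {x} 0≤y h y≥ = ℤ.≰⇒> λ le →
      not-both 0≤y h (0≤-by (ℤ.neg-mono-≤ le) (neg X (p * x))) y≥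
    below′ : ∀ {x y} → 0ℤ ≤ y → 0ℤ ≤ q * w + x * y - (x * y + x * y + Z) →
      0ℤ ≤ p * x - X → 0ℤ < Y - p * y
    below′ {y = y} 0≤y h x≥ = ℤ.≰⇒> λ le →
      not-both 0≤y h x≥ (0≤-by (ℤ.neg-mono-≤ le) (neg Y (p * y)))

open IntegerInequalities

-- The three density conditions after removing vertices and edges

module DensityBounds where
  open import Data.Integer using (+_; _+_; _*_; _-_; _≤_; _<_)

  private
    0≤# : ∀ n → 0ℤ ≤ + n
    0≤# n = +≤+ z≤n

  module _ n K e (0≤K : 0ℤ ≤ K) (0≤e : 0ℤ ≤ e) (n≥ : 0ℤ ≤ n - (+ 5 * K + + 7))
           (dense : 0ℤ < e * e + n * (n - K) * e - n * n * (n * n)) where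

    n-K>0 : 0ℤ < n - K
    n-K>0 = 0<-by (0<+≤ {+ 7} (+<+ (s≤s z≤n)) (0≤+ n≥ (0≤* (0≤# 4) 0≤K))) (eq n K)
      where
      eq : ∀ n K → + 7 + (n - (+ 5 * K + + 7) + + 4 * K) ≡ n - K
      eq = solve-∀

    n>0 : 0ℤ < n
    n>0 = 0<-by (0<+≤ n-K>0 0≤K) (eq n K)
      where
      eq : ∀ n K → n - K + K ≡ n
      eq = solve-∀

    private
      0≤n : 0ℤ ≤ n
      0≤n = 0<⇒0≤ n>0
      0≤n-K : 0ℤ ≤ n - K
      0≤n-K = 0<⇒0≤ n-K>0

    -- The expression in `dense` increases with `e`, so it is enough that it is not positive at e =
    -- n(10K + 6)/3. There the hypothesis `n≥` is nearly sharp: for n = cK the coefficient of K² in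
    -- what must be nonnegative is 9c² - 30c - 70, whose positive root lies just below 5.
    3e≥ : 0ℤ ≤ + 3 * e - n * (+ 10 * K + + 6)
    3e≥ = ℤ.≮⇒≥ λ lt →
      let g>3e = 0<-by (ℤ.neg-mono-< lt) (e₁ n K e)
          g≥0 = 0≤* 0≤n (0≤+ (0≤* (0≤# 10) 0≤K) (0≤# 6))
      in absurd (0<* {+ 9} (+<+ (s≤s z≤n)) dense)
        (0≤+ (0≤+ (0≤* (0<⇒0≤ g>3e) (0≤+ g≥0 (0≤* (0≤# 3) 0≤e)))
                  (0≤* (0≤* (0≤* (0≤# 3) 0≤n) 0≤n-K) (0<⇒0≤ g>3e)))
             (0≤* (0≤* 0≤n 0≤n)
               (0≤+ (0≤+ (0≤+ (0≤+ (0≤* (0≤# 5) (0≤* 0≤K 0≤K)) (0≤* (0≤# 228) 0≤K)) (0≤# 279))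
                         (0≤* n≥ (0≤+ (0≤* (0≤# 60) 0≤K) (0≤# 108))))
                    (0≤* (0≤# 9) (0≤* n≥ n≥)))))
        (e₂ n K e)
      where
      e₁ : ∀ n K e → ℤ.- (+ 3 * e - n * (+ 10 * K + + 6)) ≡ n * (+ 10 * K + + 6) - + 3 * e
      e₁ = solve-∀
      e₂ : ∀ n K e → + 9 * (e * e + n * (n - K) * e - n * n * (n * n))
        + ((n * (+ 10 * K + + 6) - + 3 * e) * (n * (+ 10 * K + + 6) + + 3 * e)
          + + 3 * n * (n - K) * (n * (+ 10 * K + + 6) - + 3 * e)
          + n * n * (+ 5 * (K * K) + + 228 * K + + 279
                     + (n - (+ 5 * K + + 7)) * (+ 60 * K + + 108)
                     + + 9 * ((n - (+ 5 * K + + 7)) * (n - (+ 5 * K + + 7))))) ≡ 0ℤ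
      e₂ = solve-∀

    -- At e = n(n + K)/2, four times the expression in `dense` is exactly -n²(n - K)².
    2e≥ : 0ℤ ≤ + 2 * e - n * (n + K)
    2e≥ = ℤ.≮⇒≥ λ lt →
      let g>2e = 0<-by (ℤ.neg-mono-< lt) (e₁ n K e)
          g≥0 = 0≤* 0≤n (0≤+ 0≤n 0≤K)
      in absurd (0<* {+ 4} (+<+ (s≤s z≤n)) dense)
        (0≤+ (0≤+ (0≤* (0<⇒0≤ g>2e) (0≤+ g≥0 (0≤* (0≤# 2) 0≤e)))
                  (0≤* (0≤* (0≤* (0≤# 2) 0≤n) 0≤n-K) (0<⇒0≤ g>2e)))
             (0≤* (0≤* 0≤n 0≤n) (0≤* 0≤n-K 0≤n-K)))
        (e₂ n K e)
      where
      e₁ : ∀ n K e → ℤ.- (+ 2 * e - n * (n + K)) ≡ n * (n + K) - + 2 * e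
      e₁ = solve-∀
      e₂ : ∀ n K e → + 4 * (e * e + n * (n - K) * e - n * n * (n * n))
        + ((n * (n + K) - + 2 * e) * (n * (n + K) + + 2 * e)
          + + 2 * n * (n - K) * (n * (n + K) - + 2 * e)
          + n * n * ((n - K) * (n - K))) ≡ 0ℤ
      e₂ = solve-∀

    module _ (e≤ : 0ℤ ≤ n * (n - K) - e) where

      M≥0 : 0ℤ ≤ n * n - e
      M≥0 = 0≤-by (0≤+ e≤ (0≤* 0≤n 0≤K)) (eq n K e)
        where
        eq : ∀ n K e → n * (n - K) - e + n * K ≡ n * n - e
        eq = solve-∀

      module _ i j l (0≤i : 0ℤ ≤ i) (0≤j : 0ℤ ≤ j) (0≤l : 0ℤ ≤ l)
               (R≤K : 0ℤ ≤ K - (i + j + l)) where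

        K-i≥0 : 0ℤ ≤ K - i
        K-i≥0 = 0≤-by (0≤+ R≤K (0≤+ 0≤j 0≤l)) (eq K i j l)
          where
          eq : ∀ K i j l → K - (i + j + l) + (j + l) ≡ K - i
          eq = solve-∀

        a>0 : 0ℤ < n - i
        a>0 = 0<-by (0<+≤ n-K>0 K-i≥0) (eq n K i)
          where
          eq : ∀ n K i → n - K + (K - i) ≡ n - i
          eq = solve-∀

        -- The cap on `e` enters here. If j < i, then (n - i)(n - j) exceeds (n - i)² by at most nK,
        -- and the cap keeps `n * n - e` at least nK.
        p≤a² : 0ℤ ≤ (n - i) * (n - i) - ((n - i) * (n - j) - (n * n - e))
        p≤a² = 0≤-by (0≤+ (0≤+ (0≤* (0<⇒0≤ a>0) 0≤j) e≤) (0≤+ (0≤* 0≤n K-i≥0) (0≤* 0≤i 0≤i)))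
                     (eq n K e i j)
          where
          eq : ∀ n K e i j → (n - i) * j + (n * (n - K) - e) + (n * (K - i) + i * i)
            ≡ (n - i) * (n - i) - ((n - i) * (n - j) - (n * n - e))
          eq = solve-∀

        G>0 : 0ℤ < + 2 * e - + 2 * n * j - n * i
        G>0 = 0<-by (0<+≤ (0<* n>0 n-K>0)
                (0≤+ 2e≥ (0≤* 0≤n (0≤+ (0≤+ (0≤* (0≤# 2) R≤K) (0≤* (0≤# 2) 0≤l)) 0≤i))))
                (eq n K e i j l)
          where
          eq : ∀ n K e i j l → n * (n - K) + (+ 2 * e - n * (n + K)
                 + n * (+ 2 * (K - (i + j + l)) + + 2 * l + i)) ≡ + 2 * e - + 2 * n * j - n * i
          eq = solve-∀

        -- Divided by 2n(n - i), this bounds the average degree left in a part of n - i vertices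
        -- below by e/n - j - i/2. Being linear in `i` and `j`, the bound can be multiplied with its
        -- counterpart for `l` and compared with `dense`. The slack is i(2e - n(n + i)).
        2np≥ : 0ℤ ≤ + 2 * n * ((n - i) * (n - j) - (n * n - e))
                    - (n - i) * (+ 2 * e - + 2 * n * j - n * i)
        2np≥ = 0≤-by (0≤* 0≤i (0≤+ 2e≥ (0≤* 0≤n K-i≥0))) (eq n K e i j)
          where
          eq : ∀ n K e i j → i * (+ 2 * e - n * (n + K) + n * (K - i))
            ≡ + 2 * n * ((n - i) * (n - j) - (n * n - e)) - (n - i) * (+ 2 * e - + 2 * n * j - n * i)
          eq = solve-∀

        p>0 : 0ℤ < (n - i) * (n - j) - (n * n - e)
        p>0 = 0<-cancel (0<* {+ 2} (+<+ (s≤s z≤n)) n>0)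
          (0<-by (0<+≤ (0<* a>0 G>0) 2np≥) (eq ((n - i) * (+ 2 * e - + 2 * n * j - n * i)) _))
          where
          eq : ∀ a b → a + (b - a) ≡ b
          eq = solve-∀

      module _ i j l m (0≤i : 0ℤ ≤ i) (0≤j : 0ℤ ≤ j) (0≤l : 0ℤ ≤ l) (0≤m : 0ℤ ≤ m)
               (R+m≤K : 0ℤ ≤ K - (i + j + l + m))
               E₁ E₂ E₃ (0≤E₁ : 0ℤ ≤ E₁) (0≤E₂ : 0ℤ ≤ E₂) (0≤E₃ : 0ℤ ≤ E₃)
               (E≤ : 0ℤ ≤ + 10 * (m * m) + + 6 * m - + 3 * (E₁ + E₂ + E₃)) where

        private
          M a b c p q E G₁ G₂ : ℤ.ℤ
          M = n * n - e
          a = n - i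
          b = n - j
          c = n - l
          p = a * b - M
          q = a * c - M
          E = E₁ + E₂ + E₃
          G₁ = + 2 * e - + 2 * n * j - n * i
          G₂ = + 2 * e - + 2 * n * l - n * i

          R≤K : 0ℤ ≤ K - (i + j + l)
          R≤K = 0≤-by (0≤+ R+m≤K 0≤m) (eq K i j l m)
            where
            eq : ∀ K i j l m → K - (i + j + l + m) + m ≡ K - (i + j + l)
            eq = solve-∀
          R≤K′ : 0ℤ ≤ K - (i + l + j)
          R≤K′ = 0≤-by R≤K (eq K i j l)
            where
            eq : ∀ K i j l → K - (i + j + l) ≡ K - (i + l + j)
            eq = solve-∀

          K-m≥0 : 0ℤ ≤ K - m
          K-m≥0 = 0≤-by (0≤+ R+m≤K (0≤+ (0≤+ 0≤i 0≤j) 0≤l)) (eq K i j l m)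
            where
            eq : ∀ K i j l m → K - (i + j + l + m) + (i + j + l) ≡ K - m
            eq = solve-∀

          0<a : 0ℤ < a
          0<a = a>0 i j l 0≤i 0≤j 0≤l R≤K
          0<p : 0ℤ < p
          0<p = p>0 i j l 0≤i 0≤j 0≤l R≤K
          0<q : 0ℤ < q
          0<q = p>0 i l j 0≤i 0≤l 0≤j R≤K′
          a²-p≥0 : 0ℤ ≤ a * a - p
          a²-p≥0 = p≤a² i j l 0≤i 0≤j 0≤l R≤K
          a²-q≥0 : 0ℤ ≤ a * a - q
          a²-q≥0 = p≤a² i l j 0≤i 0≤l 0≤j R≤K′

          -- Up to a nonnegative product, G₁G₂ - 4n²M is four times the expression in `dense` with
          -- `K` replaced by i + j + l. The difference of at least `m` between the two is worth
          -- 4nem, which covers 4n²E by `3e≥` and 3E ≤ 10m² + 6m ≤ m(10K + 6).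
          GG : 0ℤ < + 3 * (G₁ * G₂ - + 4 * (n * n) * (M + E))
          GG = 0<-by
            (0<+≤ (0<* {+ 12} (+<+ (s≤s z≤n)) dense)
              (0≤+ (0≤+ (0≤* 0≤12n (0≤* 0≤e R+m≤K))
                        (0≤* (0≤* (0≤# 4) 0≤n)
                          (0≤+ (0≤* 0≤m 3e≥) (0≤* 0≤n (0≤+ (0≤* (0≤* (0≤# 10) 0≤m) K-m≥0) E≤)))))
                   (0≤* (0≤# 3) (0≤* (0≤+ (0≤* (0≤* (0≤# 2) 0≤n) 0≤j) 0≤ni)
                                       (0≤+ (0≤* (0≤* (0≤# 2) 0≤n) 0≤l) 0≤ni)))))
            (eq n K e i j l m E)
            where
            0≤12n : 0ℤ ≤ + 12 * n
            0≤12n = 0≤* (0≤# 12) 0≤n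
            0≤ni : 0ℤ ≤ n * i
            0≤ni = 0≤* 0≤n 0≤i
            eq : ∀ n K e i j l m E →
              + 12 * (e * e + n * (n - K) * e - n * n * (n * n))
              + (+ 12 * n * (e * (K - (i + j + l + m)))
                 + + 4 * n * (m * (+ 3 * e - n * (+ 10 * K + + 6))
                     + n * (+ 10 * m * (K - m) + (+ 10 * (m * m) + + 6 * m - + 3 * E)))
                 + + 3 * ((+ 2 * n * j + n * i) * (+ 2 * n * l + n * i)))
              ≡ + 3 * ((+ 2 * e - + 2 * n * j - n * i) * (+ 2 * e - + 2 * n * l - n * i)
                       - + 4 * (n * n) * (n * n - e + E))
            eq = solve-∀

          -- `2np≥` for both pairs at the first part gives pq/a² ≥ G₁G₂/4n², and `GG` compares the
          -- latter with M + E.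
          pq> : 0ℤ < p * q - a * a * (M + E)
          pq> = 0<-cancel (0<* {+ 12} (+<+ (s≤s z≤n)) (0<* n>0 n>0))
            (0<-by (0<+≤ (0<* (0<* 0<a 0<a) GG)
                         (0≤* (0≤# 3) (0≤+ (0≤* (2np≥ i j l 0≤i 0≤j 0≤l R≤K)
                                                  (0≤* (0≤* (0≤# 2) 0≤n) (0<⇒0≤ 0<q)))
                                             (0≤* (0≤* (0<⇒0≤ 0<a) (0<⇒0≤ (G>0 i j l 0≤i 0≤j 0≤l R≤K)))
                                                  (2np≥ i l j 0≤i 0≤l 0≤j R≤K′)))))
                   (eq n a G₁ G₂ p q (M + E)))
            where
            eq : ∀ n a G₁ G₂ p q D →
              a * a * (+ 3 * (G₁ * G₂ - + 4 * (n * n) * D))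
              + + 3 * ((+ 2 * n * p - a * G₁) * (+ 2 * n * q) + a * G₁ * (+ 2 * n * q - a * G₂))
              ≡ + 12 * (n * n) * (p * q - a * a * D)
            eq = solve-∀

          p-E₁>0 : 0ℤ < p - E₁
          p-E₁>0 = 0<-cancel 0<q
            (0<-by (0<+≤ pq> (0≤+ (0≤* (0≤* 0≤a 0≤a) (0≤+ M≥0 (0≤+ 0≤E₂ 0≤E₃)))
                                  (0≤* 0≤E₁ a²-q≥0)))
                   (eq a p q M E₁ E₂ E₃))
            where
            0≤a : 0ℤ ≤ a
            0≤a = 0<⇒0≤ 0<a
            eq : ∀ a p q M E₁ E₂ E₃ →
              p * q - a * a * (M + (E₁ + E₂ + E₃)) + (a * a * (M + (E₂ + E₃)) + E₁ * (a * a - q))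
              ≡ q * (p - E₁)
            eq = solve-∀

          q-E₂>0 : 0ℤ < q - E₂
          q-E₂>0 = 0<-cancel 0<p
            (0<-by (0<+≤ pq> (0≤+ (0≤* (0≤* 0≤a 0≤a) (0≤+ M≥0 (0≤+ 0≤E₁ 0≤E₃)))
                                  (0≤* 0≤E₂ a²-p≥0)))
                   (eq a p q M E₁ E₂ E₃))
            where
            0≤a : 0ℤ ≤ a
            0≤a = 0<⇒0≤ 0<a
            eq : ∀ a p q M E₁ E₂ E₃ →
              p * q - a * a * (M + (E₁ + E₂ + E₃)) + (a * a * (M + (E₁ + E₃)) + E₂ * (a * a - p))
              ≡ p * (q - E₂)
            eq = solve-∀

        -- Since `p` and `q` are at most a², passing from pq to (p - E₁)(q - E₂) loses at most a²(E₁
        -- + E₂). What `pq>` leaves still exceeds a²(M + E₃), which bounds a²(bc - Z).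
        density-condition : ∀ X Y Z →
          0ℤ ≤ X + E₁ + (n * n - e) - (n - i) * (n - j) →
          0ℤ ≤ Y + E₂ + (n * n - e) - (n - i) * (n - l) →
          0ℤ ≤ Z + E₃ + (n * n - e) - (n - j) * (n - l) →
          0ℤ < X * Y - (n - i) * (n - i) * ((n - j) * (n - l) - Z)
        density-condition X Y Z hX hY hZ =
          0<-by (0<+≤ pq> (0≤+ (0≤+ (0≤+ (0≤* 0≤E₁ a²-q≥0) (0≤* 0≤E₂ a²-p≥0)) (0≤* 0≤E₁ 0≤E₂))
                     (0≤+ (0≤+ (0≤* hX (0≤+ hY (0<⇒0≤ q-E₂>0))) (0≤* (0<⇒0≤ p-E₁>0) hY))
                          (0≤* (0≤* (0<⇒0≤ 0<a) (0<⇒0≤ 0<a)) hZ))))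
                (eq a b c M E₁ E₂ E₃ X Y Z)
          where
          eq : ∀ a b c M E₁ E₂ E₃ X Y Z →
            (a * b - M) * (a * c - M) - a * a * (M + (E₁ + E₂ + E₃))
            + (E₁ * (a * a - (a * c - M)) + E₂ * (a * a - (a * b - M)) + E₁ * E₂
               + ((X + E₁ + M - a * b) * (Y + E₂ + M - a * c + (a * c - M - E₂))
                  + (a * b - M - E₁) * (Y + E₂ + M - a * c)
                  + a * a * (Z + E₃ + M - b * c)))
            ≡ X * Y - a * a * (b * c - Z)
          eq = solve-∀

      density-conditions : ∀ i j l m E₁ E₂ E₃ {p q w} X Y Z →
        0ℤ ≤ i → 0ℤ ≤ j → 0ℤ ≤ l → 0ℤ ≤ m → 0ℤ ≤ K - (i + j + l + m) →
        0ℤ ≤ E₁ → 0ℤ ≤ E₂ → 0ℤ ≤ E₃ →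
        0ℤ ≤ + 10 * (m * m) + + 6 * m - + 3 * (E₁ + E₂ + E₃) →
        p ≡ n - i → q ≡ n - j → w ≡ n - l →
        0ℤ ≤ X + E₁ + (n * n - e) - p * q →
        0ℤ ≤ Y + E₂ + (n * n - e) - p * w →
        0ℤ ≤ Z + E₃ + (n * n - e) - q * w →
        0ℤ < X * Y - p * p * (q * w - Z) ×
        0ℤ < X * Z - q * q * (p * w - Y) ×
        0ℤ < Y * Z - w * w * (p * q - X)
      density-conditions i j l m E₁ E₂ E₃ X Y Z 0≤i 0≤j 0≤l 0≤m R 0≤E₁ 0≤E₂ 0≤E₃ E≤
        refl refl refl hX hY hZ =
        density-condition i j l m 0≤i 0≤j 0≤l 0≤m R
          E₁ E₂ E₃ 0≤E₁ 0≤E₂ 0≤E₃ E≤ X Y Z hX hY hZ ,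
        density-condition j i l m 0≤j 0≤i 0≤l 0≤m (0≤-by R (R₁ K i j l m))
          E₁ E₃ E₂ 0≤E₁ 0≤E₃ 0≤E₂ (0≤-by E≤ (S₁ m E₁ E₂ E₃)) X Z Y
          (0≤-by hX (cong (λ x → X + E₁ + (n * n - e) - x) (ℤ.*-comm (n - i) (n - j)))) hZ hY ,
        density-condition l i j m 0≤l 0≤i 0≤j 0≤m (0≤-by R (R₂ K i j l m))
          E₂ E₃ E₁ 0≤E₂ 0≤E₃ 0≤E₁ (0≤-by E≤ (S₂ m E₁ E₂ E₃)) Y Z X
          (0≤-by hY (cong (λ x → Y + E₂ + (n * n - e) - x) (ℤ.*-comm (n - i) (n - l))))
          (0≤-by hZ (cong (λ x → Z + E₃ + (n * n - e) - x) (ℤ.*-comm (n - j) (n - l)))) hX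
        where
        R₁ : ∀ K i j l m → K - (i + j + l + m) ≡ K - (j + i + l + m)
        R₁ = solve-∀
        R₂ : ∀ K i j l m → K - (i + j + l + m) ≡ K - (l + i + j + m)
        R₂ = solve-∀
        S₁ : ∀ m E₁ E₂ E₃ → + 10 * (m * m) + + 6 * m - + 3 * (E₁ + E₂ + E₃)
          ≡ + 10 * (m * m) + + 6 * m - + 3 * (E₁ + E₃ + E₂)
        S₁ = solve-∀
        S₂ : ∀ m E₁ E₂ E₃ → + 10 * (m * m) + + 6 * m - + 3 * (E₁ + E₂ + E₃)
          ≡ + 10 * (m * m) + + 6 * m - + 3 * (E₂ + E₃ + E₁)
        S₂ = solve-∀

  -- The value at e = n(n - K) is n²(2(n - K)² - n²), and n ≥ 5K + 7 makes n - K larger than n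
  -- divided by the square root of 2.
  dense-cap : ∀ n K → 0ℤ ≤ K → 0ℤ ≤ n - (+ 5 * K + + 7) →
    0ℤ < n * (n - K) * (n * (n - K)) + n * (n - K) * (n * (n - K)) - n * n * (n * n)
  dense-cap n K 0≤K n≥ = 0<-by
    (0<* (0<* 0<n 0<n)
      (0<+≤ (+<+ {n = 49} (s≤s z≤n)) (0≤+ (0≤+ (0≤* (0≤# 7) (0≤* 0≤K 0≤K)) (0≤* (0≤# 42) 0≤K))
                                        (0≤* n≥ (0≤+ n≥ (0≤+ (0≤* (0≤# 6) 0≤K) (0≤# 14)))))))
    (eq n K)
    where
    0<n : 0ℤ < n
    0<n = 0<-by (0<+≤ (+<+ {n = 7} (s≤s z≤n)) (0≤+ n≥ (0≤* (0≤# 5) 0≤K))) (e n K)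
      where
      e : ∀ n K → + 7 + (n - (+ 5 * K + + 7) + + 5 * K) ≡ n
      e = solve-∀
    eq : ∀ n K → n * n * (+ 49 + (+ 7 * (K * K) + + 42 * K
                   + (n - (+ 5 * K + + 7)) * (n - (+ 5 * K + + 7) + (+ 6 * K + + 14))))
      ≡ n * (n - K) * (n * (n - K)) + n * (n - K) * (n * (n - K)) - n * n * (n * n)
    eq = solve-∀

  -- With A the sum of the aᵢ and C that of the cᵢ, the three terms add up to 3m² + (a₀a₁ + a₀a₂ +
  -- a₁a₂) + 2C. The middle term is at most A²/3 and A + C ≤ m, whence (10m² + 6m)/3. Doubling the
  -- claim turns the defect in the bound A²/3 into the three squares of differences.
  deletion-count : ∀ m a₀ a₁ a₂ c₀ c₁ c₂ →
    0ℤ ≤ a₀ → 0ℤ ≤ a₁ → 0ℤ ≤ a₂ → 0ℤ ≤ c₀ → 0ℤ ≤ c₁ → 0ℤ ≤ c₂ →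
    0ℤ ≤ m - (a₀ + a₁ + a₂ + (c₀ + c₁ + c₂)) →
    let E = λ a c b d → (m - a) * (m - b) + ((a * m + c) + (b * m + d)) in
    0ℤ ≤ + 10 * (m * m) + + 6 * m - + 3 * (E a₀ c₀ a₁ c₁ + E a₀ c₀ a₂ c₂ + E a₁ c₁ a₂ c₂)
  deletion-count m a₀ a₁ a₂ c₀ c₁ c₂ 0≤a₀ 0≤a₁ 0≤a₂ 0≤c₀ 0≤c₁ 0≤c₂ m≥ =
    0≤-by (ℤ.*-cancelˡ-≤-pos 0ℤ _ (+ 2) (0≤-by
      (0≤+ (0≤+ (0≤+ (sq (a₀ - a₁)) (sq (a₀ - a₂))) (sq (a₁ - a₂)))
           (0≤+ (0≤* (0≤* (0≤# 2) U≥0) (0≤+ (0≤* (0≤# 2) A≥0) U≥0)) (0≤* (0≤# 12) (0≤+ m≥ A≥0))))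
      (eq m a₀ a₁ a₂ c₀ c₁ c₂))) refl
    where
    sq : ∀ i → 0ℤ ≤ i * i
    sq (+ k) = 0≤* (0≤# k) (0≤# k)
    sq ℤ.-[1+ k ] = +≤+ z≤n
    A≥0 : 0ℤ ≤ a₀ + a₁ + a₂
    A≥0 = 0≤+ (0≤+ 0≤a₀ 0≤a₁) 0≤a₂
    U≥0 : 0ℤ ≤ m - (a₀ + a₁ + a₂ + (c₀ + c₁ + c₂)) + (c₀ + c₁ + c₂)
    U≥0 = 0≤+ m≥ (0≤+ (0≤+ 0≤c₀ 0≤c₁) 0≤c₂)
    eq : ∀ m a₀ a₁ a₂ c₀ c₁ c₂ →
      (a₀ - a₁) * (a₀ - a₁) + (a₀ - a₂) * (a₀ - a₂) + (a₁ - a₂) * (a₁ - a₂)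
      + (+ 2 * (m - (a₀ + a₁ + a₂ + (c₀ + c₁ + c₂)) + (c₀ + c₁ + c₂))
           * (+ 2 * (a₀ + a₁ + a₂) + (m - (a₀ + a₁ + a₂ + (c₀ + c₁ + c₂)) + (c₀ + c₁ + c₂)))
         + + 12 * (m - (a₀ + a₁ + a₂ + (c₀ + c₁ + c₂)) + (a₀ + a₁ + a₂)))
      ≡ + 2 * (+ 10 * (m * m) + + 6 * m - + 3 *
          ((m - a₀) * (m - a₁) + ((a₀ * m + c₀) + (a₁ * m + c₁))
           + ((m - a₀) * (m - a₂) + ((a₀ * m + c₀) + (a₂ * m + c₂)))
           + ((m - a₁) * (m - a₂) + ((a₁ * m + c₁) + (a₂ * m + c₂)))))
    eq = solve-∀

-- From the real root `τ` to an integer inequality on edge counts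

module RationalQuadratic where
  open import Data.Integer using (+_)
  open import Data.Rational using (ℚ; 0ℚ; 1ℚ; _+_; _*_; _-_; -_; _<_; _≤_; _/_; ∣_∣)
  open +-*-Solver using (solve; _:+_; _:*_; _:-_; :-_; _:=_; con)

  ι : ℤ.ℤ → ℚ
  ι i = i / 1

  private
    toℚᵘ-ι : ∀ i → ℚ.toℚᵘ (ι i) ℚᵘ.≃ ℚᵘ.mkℚᵘ i 0
    toℚᵘ-ι i = ℚ.toℚᵘ-fromℚᵘ (ℚᵘ.mkℚᵘ i 0)

  ι-+ : ∀ i j → ι (i ℤ.+ j) ≡ ι i + ι j
  ι-+ i j = ℚ.toℚᵘ-injective (begin
    ℚ.toℚᵘ (ι (i ℤ.+ j))                ≈⟨ toℚᵘ-ι (i ℤ.+ j) ⟩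
    ℚᵘ.mkℚᵘ (i ℤ.+ j) 0                 ≈⟨ ℚᵘ.*≡* (eq i j) ⟩
    ℚᵘ.mkℚᵘ i 0 ℚᵘ.+ ℚᵘ.mkℚᵘ j 0        ≈⟨ ℚᵘ.+-cong (toℚᵘ-ι i) (toℚᵘ-ι j) ⟨
    ℚ.toℚᵘ (ι i) ℚᵘ.+ ℚ.toℚᵘ (ι j)      ≈⟨ ℚ.toℚᵘ-homo-+ (ι i) (ι j) ⟨
    ℚ.toℚᵘ (ι i + ι j)                  ∎)
    where
    open import Relation.Binary.Reasoning.Setoid ℚᵘ.≃-setoid
    eq : ∀ i j → (i ℤ.+ j) ℤ.* + 1 ≡ (i ℤ.* + 1 ℤ.+ j ℤ.* + 1) ℤ.* + 1
    eq = solve-∀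

  ι-* : ∀ i j → ι (i ℤ.* j) ≡ ι i * ι j
  ι-* i j = ℚ.toℚᵘ-injective (begin
    ℚ.toℚᵘ (ι (i ℤ.* j))                ≈⟨ toℚᵘ-ι (i ℤ.* j) ⟩
    ℚᵘ.mkℚᵘ (i ℤ.* j) 0                 ≈⟨ ℚᵘ.*≡* refl ⟩
    ℚᵘ.mkℚᵘ i 0 ℚᵘ.* ℚᵘ.mkℚᵘ j 0        ≈⟨ ℚᵘ.*-cong (toℚᵘ-ι i) (toℚᵘ-ι j) ⟨
    ℚ.toℚᵘ (ι i) ℚᵘ.* ℚ.toℚᵘ (ι j)      ≈⟨ ℚ.toℚᵘ-homo-* (ι i) (ι j) ⟨
    ℚ.toℚᵘ (ι i * ι j)                  ∎)
    where open import Relation.Binary.Reasoning.Setoid ℚᵘ.≃-setoid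

  ι-neg : ∀ i → ι (ℤ.- i) ≡ - ι i
  ι-neg i = ℚ.toℚᵘ-injective (begin
    ℚ.toℚᵘ (ι (ℤ.- i))      ≈⟨ toℚᵘ-ι (ℤ.- i) ⟩
    ℚᵘ.- ℚᵘ.mkℚᵘ i 0        ≈⟨ ℚᵘ.-‿cong (toℚᵘ-ι i) ⟨
    ℚᵘ.- ℚ.toℚᵘ (ι i)       ≈⟨ ℚ.toℚᵘ-homo‿- (ι i) ⟨
    ℚ.toℚᵘ (- ι i)          ∎)
    where open import Relation.Binary.Reasoning.Setoid ℚᵘ.≃-setoid

  ι-reflects-0< : ∀ i → 0ℚ < ι i → 0ℤ ℤ.< i
  ι-reflects-0< i lt with ℚᵘ.*<* lt′ ← ℚᵘ.<-respʳ-≃ (toℚᵘ-ι i) (ℚ.toℚᵘ-mono-< lt) =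
    subst (0ℤ ℤ.<_) (ℤ.*-identityʳ i) lt′

  0≤ι : ∀ n → 0ℚ ≤ ι (+ n)
  0≤ι n = ℚ.nonNegative⁻¹ (ι (+ n)) {{ℚ.normalize-nonNeg n 1}}

  /-cancel : ∀ e n .{{_ : ℕ.NonZero n}} .{{_ : ℕ.NonZero (n ℕ.* n)}} →
    (+ e / (n ℕ.* n)) * (ι (+ n) * ι (+ n)) ≡ ι (+ e)
  /-cancel e (suc n) = ℚ.toℚᵘ-injective (begin
    ℚ.toℚᵘ (d * (ν * ν))                      ≈⟨ ℚ.toℚᵘ-homo-* d (ν * ν) ⟩
    ℚ.toℚᵘ d ℚᵘ.* ℚ.toℚᵘ (ν * ν)              ≡⟨ cong (λ x → ℚ.toℚᵘ d ℚᵘ.* ℚ.toℚᵘ x) (ι-* (+ suc n) (+ suc n)) ⟨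
    ℚ.toℚᵘ d ℚᵘ.* ℚ.toℚᵘ (ι (+ suc n ℤ.* + suc n))
      ≈⟨ ℚᵘ.*-cong (ℚ.toℚᵘ-fromℚᵘ (+ e ℚᵘ./ (suc n ℕ.* suc n))) (toℚᵘ-ι (+ suc n ℤ.* + suc n)) ⟩
    (+ e ℚᵘ./ (suc n ℕ.* suc n)) ℚᵘ.* ℚᵘ.mkℚᵘ (+ suc n ℤ.* + suc n) 0
      ≈⟨ ℚᵘ.*≡* (eq (+ e) (+ suc n ℤ.* + suc n)) ⟩
    ℚᵘ.mkℚᵘ (+ e) 0                           ≈⟨ toℚᵘ-ι (+ e) ⟨
    ℚ.toℚᵘ (ι (+ e))                          ∎)
    where
    open import Relation.Binary.Reasoning.Setoid ℚᵘ.≃-setoid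
    eq : ∀ i j → i ℤ.* j ℤ.* + 1 ≡ i ℤ.* (j ℤ.* + 1)
    eq = solve-∀
    ν d : ℚ
    ν = ι (+ suc n)
    d = + e / (suc n ℕ.* suc n)

  *-nonNeg : ∀ {p q} → 0ℚ ≤ p → 0ℚ ≤ q → 0ℚ ≤ p * q
  *-nonNeg {p} {q} 0≤p 0≤q = ℚ.nonNegative⁻¹ (p * q)
    {{ℚ.nonNeg*nonNeg⇒nonNeg p {{ℚ.nonNegative 0≤p}} q {{ℚ.nonNegative 0≤q}}}}

  *-pos : ∀ {p q} → 0ℚ < p → 0ℚ < q → 0ℚ < p * q
  *-pos {p} {q} 0<p 0<q = ℚ.positive⁻¹ (p * q)
    {{ℚ.pos*pos⇒pos p {{ℚ.positive 0<p}} q {{ℚ.positive 0<q}}}}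

  <⇒0< : ∀ {p q} → p < q → 0ℚ < q - p
  <⇒0< {p} {q} p<q = subst (_< q - p) (ℚ.+-inverseʳ p) (ℚ.+-mono-<-≤ p<q (ℚ.≤-refl { - p}))

  ∣∣<⇒-< : ∀ {x ε} → ∣ x ∣ < ε → 0ℚ < x + ε
  ∣∣<⇒-< {x} {ε} lt = subst (0ℚ <_) (solve 2 (λ ε x → ε :- :- x := x :+ ε) refl ε x)
    (<⇒0< (ℚ.≤-<-trans (subst (- x ≤_) (ℚ.∣-p∣≡∣p∣ x) (p≤∣p∣ (- x))) lt))
    where
    p≤∣p∣ : ∀ p → p ≤ ∣ p ∣
    p≤∣p∣ p with ℚ.≤-total 0ℚ p
    ... | inj₁ 0≤p = ℚ.≤-reflexive (sym (ℚ.0≤p⇒∣p∣≡p 0≤p))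
    ... | inj₂ p≤0 = ℚ.≤-trans p≤0 (ℚ.0≤∣p∣ p)

  -- The same ε serves for the gap and for the error at `t`. As κ ≤ N, the linear coefficient N + 1
  -- - κ is at least 1, so moving from t to D raises the quadratic by at least D - t > ε, more than
  -- the error can take away.
  quadratic-pos : ∀ N κ t D ε → 0ℚ ≤ N → κ ≤ N → 0ℚ < t → 0ℚ < ε → t + ε < D →
    ∣ N * (t * t) + (N + 1ℚ - κ) * t - N - 0ℚ ∣ < ε →
    0ℚ < N * (D * D) + (N + 1ℚ - κ) * D - N
  quadratic-pos N κ t D ε 0≤N κ≤N 0<t 0<ε t+ε<D small = subst (0ℚ <_) (eq N κ t D ε)
    (ℚ.+-mono-<-≤ (ℚ.+-mono-< (∣∣<⇒-< small) (<⇒0< t+ε<D))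
      (*-nonNeg (ℚ.<⇒≤ (<⇒0< t<D))
        (ℚ.+-mono-≤ (*-nonNeg 0≤N (ℚ.<⇒≤ (ℚ.+-mono-< (ℚ.<-trans 0<t t<D) 0<t)))
                    (subst (_≤ N - κ) (ℚ.+-inverseʳ κ) (ℚ.+-mono-≤ κ≤N (ℚ.≤-refl { - κ}))))))
    where
    t<D : t < D
    t<D = ℚ.<-trans (subst (_< t + ε) (ℚ.+-identityʳ t) (ℚ.+-mono-≤-< (ℚ.≤-refl {t}) 0<ε)) t+ε<D
    eq : ∀ N κ t D ε →
      (N * (t * t) + (N + 1ℚ - κ) * t - N - 0ℚ + ε) + (D - (t + ε))
        + (D - t) * (N * (D + t) + (N - κ))
      ≡ N * (D * D) + (N + 1ℚ - κ) * D - N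
    eq = solve 5 (λ N κ t D ε →
      (N :* (t :* t) :+ (N :+ con 1ℚ :- κ) :* t :- N :- con 0ℚ :+ ε) :+ (D :- (t :+ ε))
        :+ (D :- t) :* (N :* (D :+ t) :+ (N :- κ))
      := N :* (D :* D) :+ (N :+ con 1ℚ :- κ) :* D :- N) refl

  -- Multiplication by n³ clears the denominators, since D n² = e; the 1 of the linear coefficient
  -- cancels against k = K + 1.
  quadratic-pos-ℤ : ∀ n K e .{{_ : ℕ.NonZero n}} .{{_ : ℕ.NonZero (n ℕ.* n)}} →
    let N = ι (+ n); D = + e / (n ℕ.* n) in
    0ℚ < N * (D * D) + (N + 1ℚ - ι (+ suc K)) * D - N →
    0ℤ ℤ.< + e ℤ.* + e ℤ.+ + n ℤ.* (+ n ℤ.- + K) ℤ.* + e ℤ.- + n ℤ.* + n ℤ.* (+ n ℤ.* + n)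
  quadratic-pos-ℤ n K e pos = ι-reflects-0< _ (subst (0ℚ <_) eq
      (*-pos (*-pos 0<N (*-pos 0<N 0<N)) pos))
    where
    N D E κ : ℚ
    N = ι (+ n)
    D = + e / (n ℕ.* n)
    E = ι (+ e)
    κ = ι (+ K)
    0<N : 0ℚ < N
    0<N = ℚ.positive⁻¹ N {{ℚ.normalize-pos n 1}}
    clear : ∀ N D κ → N * (N * N) * (N * (D * D) + (N + 1ℚ - (1ℚ + κ)) * D - N)
      ≡ D * (N * N) * (D * (N * N)) + N * (N - κ) * (D * (N * N)) - N * N * (N * N)
    clear = solve 3 (λ N D κ →
      N :* (N :* N) :* (N :* (D :* D) :+ (N :+ con 1ℚ :- (con 1ℚ :+ κ)) :* D :- N)
      := D :* (N :* N) :* (D :* (N :* N)) :+ N :* (N :- κ) :* (D :* (N :* N)) :- N :* N :* (N :* N)) refl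
    ι-minus : ∀ i j → ι (i ℤ.- j) ≡ ι i - ι j
    ι-minus i j = trans (ι-+ i (ℤ.- j)) (cong (λ x → ι i + x) (ι-neg j))
    eq : N * (N * N) * (N * (D * D) + (N + 1ℚ - ι (+ suc K)) * D - N)
       ≡ ι (+ e ℤ.* + e ℤ.+ + n ℤ.* (+ n ℤ.- + K) ℤ.* + e ℤ.- + n ℤ.* + n ℤ.* (+ n ℤ.* + n))
    eq = begin
      N * (N * N) * (N * (D * D) + (N + 1ℚ - ι (+ suc K)) * D - N)
        ≡⟨ cong (λ x → N * (N * N) * (N * (D * D) + (N + 1ℚ - x) * D - N)) (ι-+ (+ 1) (+ K)) ⟩
      N * (N * N) * (N * (D * D) + (N + 1ℚ - (1ℚ + κ)) * D - N)
        ≡⟨ clear N D κ ⟩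
      D * (N * N) * (D * (N * N)) + N * (N - κ) * (D * (N * N)) - N * N * (N * N)
        ≡⟨ cong (λ x → x * x + N * (N - κ) * x - N * N * (N * N)) (/-cancel e n) ⟩
      E * E + N * (N - κ) * E - N * N * (N * N)
        ≡⟨ cong₂ _-_ (cong₂ _+_ (ι-* (+ e) (+ e))
             (trans (ι-* (+ n ℤ.* (+ n ℤ.- + K)) (+ e)) (cong (λ x → x * E)
               (trans (ι-* (+ n) (+ n ℤ.- + K)) (cong (λ x → N * x) (ι-minus (+ n) (+ K)))))))
             (trans (ι-* (+ n ℤ.* + n) (+ n ℤ.* + n)) (cong₂ _*_ (ι-* (+ n) (+ n)) (ι-* (+ n) (+ n)))) ⟨
      ι (+ e ℤ.* + e) + ι (+ n ℤ.* (+ n ℤ.- + K) ℤ.* + e) - ι (+ n ℤ.* + n ℤ.* (+ n ℤ.* + n))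
        ≡⟨ cong (λ x → x - ι (+ n ℤ.* + n ℤ.* (+ n ℤ.* + n))) (ι-+ (+ e ℤ.* + e) _) ⟨
      ι (+ e ℤ.* + e ℤ.+ + n ℤ.* (+ n ℤ.- + K) ℤ.* + e) - ι (+ n ℤ.* + n ℤ.* (+ n ℤ.* + n))
        ≡⟨ ι-minus (+ e ℤ.* + e ℤ.+ + n ℤ.* (+ n ℤ.- + K) ℤ.* + e) _ ⟨
      ι (+ e ℤ.* + e ℤ.+ + n ℤ.* (+ n ℤ.- + K) ℤ.* + e ℤ.- + n ℤ.* + n ℤ.* (+ n ℤ.* + n)) ∎
      where open ≡-Reasoning

  ι-mono : ∀ {m n} → m ℕ.≤ n → ι (+ m) ≤ ι (+ n)
  ι-mono {m} {n} m≤n = begin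
    ι (+ m)                   ≡⟨ ℚ.+-identityʳ (ι (+ m)) ⟨
    ι (+ m) + 0ℚ              ≤⟨ ℚ.+-monoʳ-≤ (ι (+ m)) (0≤ι (n ℕ.∸ m)) ⟩
    ι (+ m) + ι (+ (n ℕ.∸ m)) ≡⟨ ι-+ (+ m) (+ (n ℕ.∸ m)) ⟨
    ι (+ (m ℕ.+ (n ℕ.∸ m)))   ≡⟨ cong (λ x → ι (+ x)) (ℕ.m+[n∸m]≡n m≤n) ⟩
    ι (+ n)                   ∎
    where open ℚ.≤-Reasoning

  module _ {n : ℕ} (G : TripartiteGraph (λ _ → n)) where
    private
      size : Fin 3 → Fin 3 → ℕ
      size i j = length (edges G i j)

    minEdges : ℕ
    minEdges = (size 0F 1F ℕ.⊓ size 0F 2F) ℕ.⊓ size 1F 2F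

    density≤ : .{{_ : ℕ.NonZero n}} .{{_ : ℕ.NonZero (n ℕ.* n)}} →
      density G ≤ + minEdges / (n ℕ.* n)
    density≤ with ℕ.⊓-sel (size 0F 1F ℕ.⊓ size 0F 2F) (size 1F 2F)
                | ℕ.⊓-sel (size 0F 1F) (size 0F 2F)
    ... | inj₂ eq | _ = subst (λ m → density G ≤ + m / (n ℕ.* n)) (sym eq)
            (ℚ.p⊓q≤q (pairDensity G 0F 1F ℚ.⊓ pairDensity G 0F 2F) (pairDensity G 1F 2F))
    ... | inj₁ eq | inj₁ eq′ = subst (λ m → density G ≤ + m / (n ℕ.* n)) (sym (trans eq eq′))
            (ℚ.≤-trans (ℚ.p⊓q≤p (pairDensity G 0F 1F ℚ.⊓ pairDensity G 0F 2F) (pairDensity G 1F 2F))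
                       (ℚ.p⊓q≤p (pairDensity G 0F 1F) (pairDensity G 0F 2F)))
    ... | inj₁ eq | inj₂ eq′ = subst (λ m → density G ≤ + m / (n ℕ.* n)) (sym (trans eq eq′))
            (ℚ.≤-trans (ℚ.p⊓q≤p (pairDensity G 0F 1F ℚ.⊓ pairDensity G 0F 2F) (pairDensity G 1F 2F))
                       (ℚ.p⊓q≤q (pairDensity G 0F 1F) (pairDensity G 0F 2F)))

    -- A single term of the sequence of `τ` suffices: past all three thresholds it is positive, lies
    -- more than ε below the density, and solves the equation up to the same ε.
    density>τ⇒dense : .{{_ : ℕ.NonZero n}} → ∀ K → suc K ℕ.≤ n → ∀ τ → Isτ (suc K) n τ →
      τ <ℝ fromℚ (density G) →
      0ℤ ℤ.< + minEdges ℤ.* + minEdges ℤ.+ + n ℤ.* (+ n ℤ.- + K) ℤ.* + minEdges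
             ℤ.- + n ℤ.* + n ℤ.* (+ n ℤ.* + n)
    density>τ⇒dense {{n≢0}} K K<n τ ((ε₀ , 0<ε₀ , N₀ , τ>0) , root) (ε , 0<ε , N₁ , τ<d)
      = quadratic-pos-ℤ n K minEdges (quadratic-pos (ι (+ n)) (ι (+ suc K)) (seq τ m)
        (+ minEdges / (n ℕ.* n)) ε (0≤ι n) (ι-mono K<n)
        (ℚ.<-trans (subst (0ℚ <_) (sym (ℚ.+-identityˡ ε₀)) 0<ε₀) (τ>0 m N₀≤m)) 0<ε
        (ℚ.<-≤-trans (τ<d m N₁≤m) density≤) (proj₂ (root ε 0<ε) m N₂≤m))
      where
      instance
        _ : ℕ.NonZero (n ℕ.* n)
        _ = ℕ.m*n≢0 n n {{n≢0}} {{n≢0}}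
      N₂ m : ℕ
      N₂ = proj₁ (root ε 0<ε)
      m = N₀ ℕ.⊔ N₁ ℕ.⊔ N₂
      N₀≤m : N₀ ℕ.≤ m
      N₀≤m = ℕ.≤-trans (ℕ.m≤m⊔n N₀ N₁) (ℕ.m≤m⊔n _ N₂)
      N₁≤m : N₁ ℕ.≤ m
      N₁≤m = ℕ.≤-trans (ℕ.m≤n⊔m N₀ N₁) (ℕ.m≤m⊔n _ N₂)
      N₂≤m : N₂ ℕ.≤ m
      N₂≤m = ℕ.m≤n⊔m _ N₂

-- Finite sums over lists

open import Data.Nat using (_+_; _*_; _∸_; _⊓_; _≤_; _<_)
open import Data.Nat.Properties

𝟙 : Bool → ℕ
𝟙 true  = 1
𝟙 false = 0

𝟙-not : ∀ b → 𝟙 (not b) + 𝟙 b ≡ 1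
𝟙-not true  = refl
𝟙-not false = refl

module _ {A : Set} where

  ∑ : List A → (A → ℕ) → ℕ
  ∑ []       f = 0
  ∑ (x ∷ xs) f = f x + ∑ xs f

  ∑-cong : ∀ xs {f g} → (∀ x → f x ≡ g x) → ∑ xs f ≡ ∑ xs g
  ∑-cong []       h = refl
  ∑-cong (x ∷ xs) h = cong₂ _+_ (h x) (∑-cong xs h)

  ∑-mono-∈ : ∀ xs {f g} → (∀ {x} → x ∈ xs → f x ≤ g x) → ∑ xs f ≤ ∑ xs g
  ∑-mono-∈ []       h = z≤n
  ∑-mono-∈ (x ∷ xs) h = +-mono-≤ (h (here refl)) (∑-mono-∈ xs (h ∘ there))

  ∑-mono : ∀ xs {f g} → (∀ x → f x ≤ g x) → ∑ xs f ≤ ∑ xs g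
  ∑-mono xs h = ∑-mono-∈ xs λ {x} _ → h x

  ∑-mono-< : ∀ {xs x f g} → (∀ x → f x ≤ g x) → x ∈ xs → f x < g x → ∑ xs f < ∑ xs g
  ∑-mono-< {xs = _ ∷ xs} h (here refl) lt = +-mono-<-≤ lt (∑-mono xs h)
  ∑-mono-< h (there x∈) lt = +-mono-≤-< (h _) (∑-mono-< h x∈ lt)

  ∑-+ : ∀ xs f g → ∑ xs (λ x → f x + g x) ≡ ∑ xs f + ∑ xs g
  ∑-+ []       f g = refl
  ∑-+ (x ∷ xs) f g = trans (cong (f x + g x +_) (∑-+ xs f g)) (interchange +-commutativeSemigroup (f x) (g x) _ _)

  ∑-*ˡ : ∀ xs c f → ∑ xs (λ x → c * f x) ≡ c * ∑ xs f
  ∑-*ˡ []       c f = sym (*-zeroʳ c)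
  ∑-*ˡ (x ∷ xs) c f = trans (cong (c * f x +_) (∑-*ˡ xs c f)) (sym (*-distribˡ-+ c (f x) _))

  ∑-*ʳ : ∀ xs f c → ∑ xs (λ x → f x * c) ≡ ∑ xs f * c
  ∑-*ʳ []       f c = refl
  ∑-*ʳ (x ∷ xs) f c = trans (cong (f x * c +_) (∑-*ʳ xs f c)) (sym (*-distribʳ-+ c (f x) _))

  ∑-const : ∀ xs c → ∑ xs (λ _ → c) ≡ length xs * c
  ∑-const []       c = refl
  ∑-const (x ∷ xs) c = cong (c +_) (∑-const xs c)

  ∈⇒≤∑ : ∀ {xs x} f → x ∈ xs → f x ≤ ∑ xs f
  ∈⇒≤∑ f (here refl) = m≤m+n _ _
  ∈⇒≤∑ {x = x} f (there x∈) = ≤-trans (∈⇒≤∑ f x∈) (m≤n+m _ _)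

  ∑-filter-≤ : ∀ p xs f → ∑ (filterᵇ p xs) f ≤ ∑ xs f
  ∑-filter-≤ p []       f = z≤n
  ∑-filter-≤ p (x ∷ xs) f with p x
  ... | true  = +-monoʳ-≤ (f x) (∑-filter-≤ p xs f)
  ... | false = ≤-trans (∑-filter-≤ p xs f) (m≤n+m _ (f x))

  length-filter : ∀ p xs → length (filterᵇ p xs) ≡ ∑ xs (𝟙 ∘ p)
  length-filter p []       = refl
  length-filter p (x ∷ xs) with p x
  ... | true  = cong suc (length-filter p xs)
  ... | false = length-filter p xs

  ∈-filterᵇ : ∀ (p : A → Bool) {x} xs → x ∈ filterᵇ p xs → p x ≡ true
  ∈-filterᵇ p (y ∷ xs) x∈ with p y in eq
  ∈-filterᵇ p (y ∷ xs) (here refl) | true = eq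
  ∈-filterᵇ p (y ∷ xs) (there x∈)  | true = ∈-filterᵇ p xs x∈
  ∈-filterᵇ p (y ∷ xs) x∈          | false = ∈-filterᵇ p xs x∈

  ∑-≤⇒∃≤ : ∀ x xs f g → ∑ (x ∷ xs) f ≤ ∑ (x ∷ xs) g → ∃[ y ] y ∈ x ∷ xs × f y ≤ g y
  ∑-≤⇒∃≤ x xs f g le with f x ≤? g x
  ... | yes p = x , here refl , p
  ∑-≤⇒∃≤ x [] f g le | no p = ⊥-elim (p (+-cancelʳ-≤ 0 _ _ le))
  ∑-≤⇒∃≤ x (y ∷ ys) f g le | no p
    with z , z∈ , q ← ∑-≤⇒∃≤ y ys f g (≮⇒≥ λ lt → <⇒≱ (+-mono-< (≰⇒> p) lt) le) = z , there z∈ , q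

  ∑-δ-Unique : ∀ {xs z} (_≟_ : (x y : A) → Dec (x ≡ y)) → Unique xs → ∑ xs (λ x → 𝟙 (does (z ≟ x))) ≤ 1
  ∑-δ-Unique _≟_ [] = z≤n
  ∑-δ-Unique {x ∷ xs} {z} _≟_ (x∉ ∷ u) with z ≟ x
  ... | no _ = ∑-δ-Unique _≟_ u
  ... | yes refl = s≤s (≤-reflexive (go x∉))
    where
    go : ∀ {ys} → All (λ y → z ≢ y) ys → ∑ ys (λ y → 𝟙 (does (z ≟ y))) ≡ 0
    go [] = refl
    go {y ∷ _} (z≢y ∷ h) = cong₂ _+_ (cong 𝟙 (dec-false (z ≟ y) z≢y)) (go h)

∑-swap : ∀ {A B : Set} xs ys (f : A → B → ℕ) →
         ∑ xs (λ x → ∑ ys (f x)) ≡ ∑ ys (λ y → ∑ xs (λ x → f x y))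
∑-swap []       ys f = sym (trans (∑-const ys 0) (*-zeroʳ (length ys)))
∑-swap (x ∷ xs) ys f = trans (cong (∑ ys (f x) +_) (∑-swap xs ys f)) (sym (∑-+ ys (f x) _))

∑-* : ∀ {A B : Set} xs ys (f : A → ℕ) (g : B → ℕ) →
      ∑ xs (λ x → ∑ ys (λ y → f x * g y)) ≡ ∑ xs f * ∑ ys g
∑-* xs ys f g = trans (∑-cong xs λ x → ∑-*ˡ ys (f x) g) (∑-*ʳ xs f (∑ ys g))

∑-allFin-1 : ∀ n → ∑ (allFin n) (λ _ → 1) ≡ n
∑-allFin-1 n = trans (∑-const (allFin n) 1) (trans (*-identityʳ _) (length-tabulate id))

∑-δ : ∀ {n} (z : Fin n) → ∑ (allFin n) (λ x → 𝟙 (does (z Fin.≟ x))) ≤ 1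
∑-δ {n} z = ∑-δ-Unique {z = z} Fin._≟_ (allFin⁺ n)

∑-1 : ∀ {A : Set} (xs : List A) → ∑ xs (λ _ → 1) ≡ length xs
∑-1 xs = trans (∑-const xs 1) (*-identityʳ _)

∑-𝟙≤ : ∀ {A : Set} (xs : List A) b → ∑ xs (𝟙 ∘ b) ≤ length xs
∑-𝟙≤ xs b = ≤-trans (∑-mono xs λ x → 𝟙≤1 (b x)) (≤-reflexive (∑-1 xs))
  where
  𝟙≤1 : ∀ c → 𝟙 c ≤ 1
  𝟙≤1 true  = ≤-refl
  𝟙≤1 false = z≤n

-- Triangle-free tripartite graphs cannot be dense in all three conditions

pos-∸ : ∀ {m n} → n ≤ m → ℤ.+ (m ∸ n) ≡ ℤ.+ m ℤ.- ℤ.+ n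
pos-∸ {m} {n} n≤m = sym (trans (ℤ.m-n≡m⊖n m n) (ℤ.⊖-≥ n≤m))

-- Both sides are the maximum of `m` and `n`.
∸-balance : ∀ m n → (m ∸ n) + n ≡ m + (n ∸ m)
∸-balance zero    n       = cong (_+ n) (0∸n≡0 n)
∸-balance (suc m) zero    = refl
∸-balance (suc m) (suc n) = trans (+-suc (m ∸ n) n) (cong suc (∸-balance m n))

-- `degree-deviations` with truncated differences. Those on the left are genuine by hypothesis,
-- those on the right because `degree-deviations` also proves the deficits positive.
deviations-ℕ : ∀ p q w X Y Z x₁ x₂ y₁ y₂ → 0 < p → x₁ ≤ q → y₂ ≤ w →
  x₁ * y₁ + x₁ * y₁ + Z ≤ q * w + x₁ * y₁ →
  x₂ * y₂ + x₂ * y₂ + Z ≤ q * w + x₂ * y₂ →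
  x₁ * y₁ + x₂ * y₂ + Z ≤ q * w + x₂ * y₁ →
  0ℤ ℤ.< ℤ.+ X ℤ.* ℤ.+ Y ℤ.- ℤ.+ p ℤ.* ℤ.+ p ℤ.* (ℤ.+ q ℤ.* ℤ.+ w ℤ.- ℤ.+ Z) →
  0ℤ ℤ.< ℤ.+ X ℤ.* ℤ.+ Z ℤ.- ℤ.+ q ℤ.* ℤ.+ q ℤ.* (ℤ.+ p ℤ.* ℤ.+ w ℤ.- ℤ.+ Y) →
  0ℤ ℤ.< ℤ.+ Y ℤ.* ℤ.+ Z ℤ.- ℤ.+ w ℤ.* ℤ.+ w ℤ.* (ℤ.+ p ℤ.* ℤ.+ q ℤ.- ℤ.+ X) →
  X ≤ p * x₁ → Y ≤ p * y₂ →
  (p * x₁ ∸ X) * (p * y₂ ∸ Y) < (Y ∸ p * y₁) * (X ∸ p * x₂)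
deviations-ℕ p q w X Y Z x₁ x₂ y₁ y₂ 0<p x₁≤q y₂≤w h₁₁ h₂₂ h₁₂ hA hB hC X≤ Y≤
  = let U>0 , V>0 , lt = degree-deviations (ℤ.+ p) (ℤ.+ q) (ℤ.+ w) (ℤ.+ X) (ℤ.+ Y) (ℤ.+ Z)
         (ℤ.+ x₁) (ℤ.+ x₂) (ℤ.+ y₁) (ℤ.+ y₂)
         (+<+ 0<p) (ℕ⇒0≤ X) (ℕ⇒0≤ Y) (ℕ⇒0≤ x₂) (ℕ⇒0≤ y₁) (ℕ⇒0≤ y₂)
         (ℤ.i≤j⇒0≤j-i (+≤+ x₁≤q)) (ℤ.i≤j⇒0≤j-i (+≤+ y₂≤w))
         (pairℤ x₁ x₁ y₁ y₁ h₁₁) (pairℤ x₂ x₂ y₂ y₂ h₂₂) (pairℤ x₁ x₂ y₁ y₂ h₁₂) hA hB hC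
         (0≤-by (ℕ⇒0≤ (p * x₁ ∸ X)) (p*-∸ X≤)) (0≤-by (ℕ⇒0≤ (p * y₂ ∸ Y)) (p*-∸ Y≤))
    in ℤ.drop‿+<+ (subst₂ ℤ._<_
      (trans (sym (cong₂ ℤ._*_ (p*-∸ X≤) (p*-∸ Y≤))) (sym (ℤ.pos-* (p * x₁ ∸ X) (p * y₂ ∸ Y))))
      (trans (sym (cong₂ ℤ._*_ (∸-p* U>0) (∸-p* V>0)))
        (trans (sym (ℤ.pos-* (X ∸ p * x₂) (Y ∸ p * y₁)))
          (cong ℤ.+_ (*-comm (X ∸ p * x₂) (Y ∸ p * y₁)))))
      lt)
  where
  ℕ⇒0≤ : ∀ n → 0ℤ ℤ.≤ ℤ.+ n
  ℕ⇒0≤ n = +≤+ z≤n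

  pairℤ : ∀ x₁ x₂ y₁ y₂ → x₁ * y₁ + x₂ * y₂ + Z ≤ q * w + x₂ * y₁ →
    0ℤ ℤ.≤ ℤ.+ q ℤ.* ℤ.+ w ℤ.+ ℤ.+ x₂ ℤ.* ℤ.+ y₁ ℤ.- (ℤ.+ x₁ ℤ.* ℤ.+ y₁ ℤ.+ ℤ.+ x₂ ℤ.* ℤ.+ y₂ ℤ.+ ℤ.+ Z)
  pairℤ x₁ x₂ y₁ y₂ h = 0≤-by (ℤ.i≤j⇒0≤j-i (+≤+ h))
    (cong₂ ℤ._-_ (cong₂ ℤ._+_ (ℤ.pos-* q w) (ℤ.pos-* x₂ y₁))
      (cong (λ z → z ℤ.+ ℤ.+ Z) (cong₂ ℤ._+_ (ℤ.pos-* x₁ y₁) (ℤ.pos-* x₂ y₂))))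

  p*-∸ : ∀ {m k} → m ≤ p * k → ℤ.+ (p * k ∸ m) ≡ ℤ.+ p ℤ.* ℤ.+ k ℤ.- ℤ.+ m
  p*-∸ {m} {k} le = trans (pos-∸ {p * k} {m} le) (cong (λ z → z ℤ.- ℤ.+ m) (ℤ.pos-* p k))

  ∸-p* : ∀ {m k} → 0ℤ ℤ.< ℤ.+ m ℤ.- ℤ.+ p ℤ.* ℤ.+ k → ℤ.+ (m ∸ p * k) ≡ ℤ.+ m ℤ.- ℤ.+ p ℤ.* ℤ.+ k
  ∸-p* {m} {k} lt = trans (pos-∸ {m} {p * k} (ℤ.drop‿+≤+ (ℤ.0≤i-j⇒j≤i (0≤-by (0<⇒0≤ lt) (sym eq))))) eq
    where
    eq : ℤ.+ m ℤ.- ℤ.+ (p * k) ≡ ℤ.+ m ℤ.- ℤ.+ p ℤ.* ℤ.+ k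
    eq = cong (λ z → ℤ.+ m ℤ.- z) (ℤ.pos-* p k)

module _ {A B C : Set} (r : A → B → Bool) (s : A → C → Bool) (t : B → C → Bool)
         (triangle-free : ∀ a b c → r a b ≡ true → s a c ≡ true → t b c ≡ true → ⊥)
         (As : List A) (Bs : List B) (Cs : List C) where

  private
    p q w : ℕ
    p = length As
    q = length Bs
    w = length Cs

    x y : A → ℕ
    x a = ∑ Bs (𝟙 ∘ r a)
    y a = ∑ Cs (𝟙 ∘ s a)

    X Y Z : ℕ
    X = ∑ As x
    Y = ∑ As y
    Z = ∑ Bs λ b → ∑ Cs (𝟙 ∘ t b)

    -- If both products on the left are 1, so is r₂s₁; and `t` being true makes both vanish. The
    -- constant is spelled `1 * 1` so that it sums to a product over the two lists.
    cover : ∀ r₁ s₁ r₂ s₂ t →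
      (r₁ ≡ true → s₁ ≡ true → t ≡ true → ⊥) → (r₂ ≡ true → s₂ ≡ true → t ≡ true → ⊥) →
      𝟙 r₁ * 𝟙 s₁ + 𝟙 r₂ * 𝟙 s₂ + 𝟙 t ≤ 1 * 1 + 𝟙 r₂ * 𝟙 s₁
    cover true  true  _     _     true  h _ = ⊥-elim (h refl refl refl)
    cover _     _     true  true  true  _ h = ⊥-elim (h refl refl refl)
    cover true  true  true  true  false _ _ = ≤-refl
    cover true  true  true  false false _ _ = s≤s z≤n
    cover true  true  false true  false _ _ = s≤s z≤n
    cover true  true  false false false _ _ = s≤s z≤n
    cover true  false true  true  false _ _ = s≤s z≤n
    cover true  false true  false true  _ _ = s≤s z≤n
    cover true  false true  false false _ _ = z≤n
    cover true  false false true  true  _ _ = s≤s z≤n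
    cover true  false false true  false _ _ = z≤n
    cover true  false false false true  _ _ = s≤s z≤n
    cover true  false false false false _ _ = z≤n
    cover false true  true  true  false _ _ = s≤s z≤n
    cover false true  true  false true  _ _ = s≤s z≤n
    cover false true  true  false false _ _ = z≤n
    cover false true  false true  true  _ _ = s≤s z≤n
    cover false true  false true  false _ _ = z≤n
    cover false true  false false true  _ _ = s≤s z≤n
    cover false true  false false false _ _ = z≤n
    cover false false true  true  false _ _ = s≤s z≤n
    cover false false true  false true  _ _ = s≤s z≤n
    cover false false true  false false _ _ = z≤n
    cover false false false true  true  _ _ = s≤s z≤n
    cover false false false true  false _ _ = z≤n
    cover false false false false true  _ _ = s≤s z≤n
    cover false false false false false _ _ = z≤n

    -- Inclusion and exclusion among the pairs in `Bs` and `Cs`: by triangle-freeness the two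
    -- rectangles formed by the neighbourhoods of `a₁` and of `a₂` contain no edge, and they
    -- intersect inside the rectangle of size `x a₂ * y a₁`.
    pair : ∀ a₁ a₂ → x a₁ * y a₁ + x a₂ * y a₂ + Z ≤ q * w + x a₂ * y a₁
    pair a₁ a₂ = begin
      x a₁ * y a₁ + x a₂ * y a₂ + Z
        ≡⟨ cong₂ (λ m n → m + n + Z) (∑-* Bs Cs _ _) (∑-* Bs Cs _ _) ⟨
      ∑∑ (λ b c → 𝟙 (r a₁ b) * 𝟙 (s a₁ c)) + ∑∑ (λ b c → 𝟙 (r a₂ b) * 𝟙 (s a₂ c)) + Z
        ≡⟨ cong (_+ Z) (∑∑-+ _ _) ⟨
      ∑∑ (λ b c → 𝟙 (r a₁ b) * 𝟙 (s a₁ c) + 𝟙 (r a₂ b) * 𝟙 (s a₂ c)) + Z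
        ≡⟨ ∑∑-+ _ _ ⟨
      ∑∑ (λ b c → 𝟙 (r a₁ b) * 𝟙 (s a₁ c) + 𝟙 (r a₂ b) * 𝟙 (s a₂ c) + 𝟙 (t b c))
        ≤⟨ ∑-mono Bs (λ b → ∑-mono Cs λ c → cover (r a₁ b) (s a₁ c) (r a₂ b) (s a₂ c) (t b c)
             (triangle-free a₁ b c) (triangle-free a₂ b c)) ⟩
      ∑∑ (λ b c → 1 * 1 + 𝟙 (r a₂ b) * 𝟙 (s a₁ c))
        ≡⟨ ∑∑-+ _ _ ⟩
      ∑∑ (λ b c → 1 * 1) + ∑∑ (λ b c → 𝟙 (r a₂ b) * 𝟙 (s a₁ c))
        ≡⟨ cong₂ _+_ (∑-* Bs Cs _ _) (∑-* Bs Cs _ _) ⟩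
      ∑ Bs (λ _ → 1) * ∑ Cs (λ _ → 1) + x a₂ * y a₁
        ≡⟨ cong₂ (λ m n → m * n + x a₂ * y a₁) (∑-1 Bs) (∑-1 Cs) ⟩
      q * w + x a₂ * y a₁ ∎
      where
      open ≤-Reasoning
      ∑∑ : (B → C → ℕ) → ℕ
      ∑∑ f = ∑ Bs λ b → ∑ Cs (f b)
      ∑∑-+ : ∀ f g → ∑∑ (λ b c → f b c + g b c) ≡ ∑∑ f + ∑∑ g
      ∑∑-+ f g = trans (∑-cong Bs λ b → ∑-+ Cs (f b) (g b)) (∑-+ Bs _ _)

  private
    -- Deviations from the average sum to zero. The factor `p` keeps the average integral.
    ∑-balance : ∀ f → ∑ As (λ a → p * f a ∸ ∑ As f) ≡ ∑ As (λ a → ∑ As f ∸ p * f a)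
    ∑-balance f = +-cancelʳ-≡ (p * F) _ _ (begin
      ∑ As (λ a → p * f a ∸ F) + p * F          ≡⟨ cong (λ z → ∑ As (λ a → p * f a ∸ F) + z) (∑-const As F) ⟨
      ∑ As (λ a → p * f a ∸ F) + ∑ As (λ _ → F) ≡⟨ ∑-+ As _ _ ⟨
      ∑ As (λ a → (p * f a ∸ F) + F)            ≡⟨ ∑-cong As (λ a → ∸-balance (p * f a) F) ⟩
      ∑ As (λ a → p * f a + (F ∸ p * f a))      ≡⟨ ∑-+ As _ _ ⟩
      ∑ As (λ a → p * f a) + _                  ≡⟨ cong (λ z → z + ∑ As (λ a → F ∸ p * f a)) (∑-*ˡ As p f) ⟩
      p * F + ∑ As (λ a → F ∸ p * f a)          ≡⟨ +-comm (p * F) _ ⟩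
      ∑ As (λ a → F ∸ p * f a) + p * F          ∎)
      where
      open ≡-Reasoning
      F : ℕ
      F = ∑ As f

    some-above : ∀ (f : A → ℕ) as → 0 < length as → ∃[ a ] a ∈ as × ∑ as f ≤ length as * f a
    some-above f (a ∷ as) _ = ∑-≤⇒∃≤ a as (λ _ → ∑ (a ∷ as) f) (λ b → length (a ∷ as) * f b) (≤-reflexive
      (trans (∑-const (a ∷ as) (∑ (a ∷ as) f)) (sym (∑-*ˡ (a ∷ as) (length (a ∷ as)) f))))

    0<length : 0ℤ ℤ.< ℤ.+ X ℤ.* ℤ.+ Y ℤ.- ℤ.+ p ℤ.* ℤ.+ p ℤ.* (ℤ.+ q ℤ.* ℤ.+ w ℤ.- ℤ.+ Z) → 0 < p
    0<length hA = n≢0⇒n>0 λ p≡0 → nonempty As p≡0 hA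
      where
      nonempty : ∀ as → length as ≡ 0 →
        ¬ (0ℤ ℤ.< ℤ.+ ∑ as x ℤ.* ℤ.+ ∑ as y ℤ.- ℤ.+ length as ℤ.* ℤ.+ length as ℤ.* (ℤ.+ q ℤ.* ℤ.+ w ℤ.- ℤ.+ Z))
      nonempty [] _ (+<+ ())

  -- Summed over all pairs (a₁, a₂), excess times excess and deficit times deficit give the same
  -- total, by `∑-balance`. But the former is at most the latter for each pair, and strictly smaller
  -- when `a₁` has at least average degree to `Bs` and `a₂` to `Cs`.
  some-density-small :
    0ℤ ℤ.< ℤ.+ X ℤ.* ℤ.+ Y ℤ.- ℤ.+ p ℤ.* ℤ.+ p ℤ.* (ℤ.+ q ℤ.* ℤ.+ w ℤ.- ℤ.+ Z) →
    0ℤ ℤ.< ℤ.+ X ℤ.* ℤ.+ Z ℤ.- ℤ.+ q ℤ.* ℤ.+ q ℤ.* (ℤ.+ p ℤ.* ℤ.+ w ℤ.- ℤ.+ Y) →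
    0ℤ ℤ.< ℤ.+ Y ℤ.* ℤ.+ Z ℤ.- ℤ.+ w ℤ.* ℤ.+ w ℤ.* (ℤ.+ p ℤ.* ℤ.+ q ℤ.- ℤ.+ X) → ⊥
  some-density-small hA hB hC
    with a₁ , a₁∈ , x₁≥ ← some-above x As (0<length hA)
       | a₂ , a₂∈ , y₂≥ ← some-above y As (0<length hA)
    = <-irrefl sums-agree (∑-mono-< {f = λ a → ∑ As λ b → U⁺ a * V⁺ b} (λ a → ∑-mono As (weak a)) a₁∈
                (∑-mono-< {f = λ b → U⁺ a₁ * V⁺ b} (weak a₁) a₂∈ (strict x₁≥ y₂≥)))
    where
    U⁺ U⁻ V⁺ V⁻ : A → ℕ
    U⁺ a = p * x a ∸ X
    U⁻ a = X ∸ p * x a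
    V⁺ a = p * y a ∸ Y
    V⁻ a = Y ∸ p * y a

    strict : ∀ {a₁ a₂} → X ≤ p * x a₁ → Y ≤ p * y a₂ → U⁺ a₁ * V⁺ a₂ < V⁻ a₁ * U⁻ a₂
    strict {a₁} {a₂} = deviations-ℕ p q w X Y Z (x a₁) (x a₂) (y a₁) (y a₂) (0<length hA)
      (∑-𝟙≤ Bs (r a₁)) (∑-𝟙≤ Cs (s a₂)) (pair a₁ a₁) (pair a₂ a₂) (pair a₁ a₂) hA hB hC

    weak : ∀ a₁ a₂ → U⁺ a₁ * V⁺ a₂ ≤ V⁻ a₁ * U⁻ a₂
    weak a₁ a₂ with X ≤? p * x a₁ | Y ≤? p * y a₂
    ... | yes X≤ | yes Y≤ = <⇒≤ (strict X≤ Y≤)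
    ... | no  X≰ | _      rewrite m≤n⇒m∸n≡0 (<⇒≤ (≰⇒> X≰)) = z≤n
    ... | yes _  | no  Y≰ rewrite m≤n⇒m∸n≡0 (<⇒≤ (≰⇒> Y≰)) | *-zeroʳ (U⁺ a₁) = z≤n

    sums-agree : ∑ As (λ a₁ → ∑ As λ a₂ → U⁺ a₁ * V⁺ a₂) ≡ ∑ As (λ a₁ → ∑ As λ a₂ → V⁻ a₁ * U⁻ a₂)
    sums-agree = begin
      ∑ As (λ a₁ → ∑ As λ a₂ → U⁺ a₁ * V⁺ a₂) ≡⟨ ∑-* As As U⁺ V⁺ ⟩
      ∑ As U⁺ * ∑ As V⁺                       ≡⟨ cong₂ _*_ (∑-balance x) (∑-balance y) ⟩
      ∑ As U⁻ * ∑ As V⁻                       ≡⟨ *-comm (∑ As U⁻) _ ⟩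
      ∑ As V⁻ * ∑ As U⁻                       ≡⟨ ∑-* As As V⁻ U⁻ ⟨
      ∑ As (λ a₁ → ∑ As λ a₂ → V⁻ a₁ * U⁻ a₂) ∎
      where open ≡-Reasoning

-- Packings of vertex-disjoint triangles

does-false⇒¬ : ∀ {A : Set} (a? : Dec A) → does a? ≡ false → ¬ A
does-false⇒¬ (no ¬a) _ = ¬a

module Packings {n : ℕ} (G : TripartiteGraph (λ _ → n)) where
  open TripartiteGraph G

  -- A triangle of a tripartite graph has exactly one vertex in each part.
  Transversal : Set
  Transversal = Fin 3 → Fin n

  IsTriangle : Transversal → Set
  IsTriangle t = ∀ i j → i ≢ j → Adj (i , t i) (j , t j)

  -- A set of forbidden vertices, Boolean-valued so that it can be counted and filtered by.
  Region : Set
  Region = Fin 3 → Fin n → Bool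

  Avoids : Region → Transversal → Set
  Avoids S t = ∀ i → S i (t i) ≡ false

  insert : Region → Fin 3 → Fin n → Region
  insert S i x j y = S j y ∨ (does (i Fin.≟ j) ∧ does (x Fin.≟ y))

  insert-misses : ∀ {S} i {x y} → insert S i x i y ≡ false → x ≢ y
  insert-misses {S} i {x} outside refl
    rewrite dec-true (i Fin.≟ i) refl | dec-true (x Fin.≟ x) refl | ∨-zeroʳ (S i x) with () ← outside

  _∪_ : Region → Transversal → Region
  (S ∪ t) i x = S i x ∨ does (t i Fin.≟ x)

  -- Disjointness is `injective`, one part at a time, because vertices of different parts never
  -- coincide.
  record Packing (S : Region) (m : ℕ) : Set where
    field
      member    : Fin m → Transversal
      triangle  : ∀ s → IsTriangle (member s)
      avoids    : ∀ s → Avoids S (member s)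
      injective : ∀ i {s s′} → member s i ≡ member s′ i → s ≡ s′
  open Packing

  weaken : ∀ {S S′ m} → (∀ i x → S′ i x ≡ false → S i x ≡ false) → Packing S′ m → Packing S m
  weaken ⊆ P = record
    { member    = member P
    ; triangle  = triangle P
    ; avoids    = λ s i → ⊆ i _ (avoids P s i)
    ; injective = injective P
    }

  extend : ∀ {S m t} → IsTriangle t → Avoids S t → (P : Packing S m) →
           (∀ s i → t i ≢ member P s i) → Packing S (suc m)
  extend {t = t} tri av P disjoint = record
    { member    = λ where zero → t; (suc s) → member P s
    ; triangle  = λ where zero → tri; (suc s) → triangle P s
    ; avoids    = λ where zero → av; (suc s) → avoids P s
    ; injective = λ where
        i {zero}  {zero}  _  → refl
        i {zero}  {suc s} eq → ⊥-elim (disjoint s i eq)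
        i {suc s} {zero}  eq → ⊥-elim (disjoint s i (sym eq))
        i {suc s} {suc _} eq → cong suc (injective P i eq)
    }

  -- A search through triples of vertices finds a transversal only up to pointwise equality, so the
  -- property sought must be invariant under it.
  Respects : (Transversal → Set) → Set
  Respects Q = ∀ {t t′} → (∀ i → t i ≡ t′ i) → Q t → Q t′

  anyTransversal? : {Q : Transversal → Set} → Respects Q → (∀ t → Dec (Q t)) → Dec (∃ Q)
  anyTransversal? {Q} Q-resp Q? = map′ (λ (a , b , c , q) → _ , q)
    (λ (t , q) → t 0F , t 1F , t 2F , Q-resp (η t) q)
    (Fin.any? λ a → Fin.any? λ b → Fin.any? λ c → Q? (triple a b c))
    where
    triple : Fin n → Fin n → Fin n → Transversal
    triple a b c 0F = a
    triple a b c 1F = b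
    triple a b c 2F = c
    η : ∀ t i → t i ≡ triple (t 0F) (t 1F) (t 2F) i
    η t 0F = refl
    η t 1F = refl
    η t 2F = refl

  isTriangle? : ∀ t → Dec (IsTriangle t)
  isTriangle? t = Fin.all? λ i → Fin.all? λ j → ¬? (i Fin.≟ j) →-dec adj? (i , t i) (j , t j)

  avoids? : ∀ S t → Dec (Avoids S t)
  avoids? S t = Fin.all? λ i → S i (t i) Bool.≟ false

  isTriangle-resp : Respects IsTriangle
  isTriangle-resp eq tri i j i≢j = subst₂ (λ x y → Adj (i , x) (j , y)) (eq i) (eq j) (tri i j i≢j)

  avoids-resp : ∀ {S} → Respects (Avoids S)
  avoids-resp {S} eq av i = subst (λ x → S i x ≡ false) (eq i) (av i)

  empty : ∀ {S} → Packing S 0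
  empty = record { member = λ (); triangle = λ (); avoids = λ (); injective = λ { _ {()} } }

  -- The first member is searched for and then forbidden to the others. This decision is what allows
  -- the induction to assume constructively that no larger packing exists.
  packing? : ∀ m S → Dec (Packing S m)
  packing? zero S = yes empty
  packing? (suc m) S = map′ join split
    (anyTransversal? first-resp λ t → isTriangle? t ×-dec avoids? S t ×-dec packing? m (S ∪ t))
    where
    First : Transversal → Set
    First t = IsTriangle t × Avoids S t × Packing (S ∪ t) m
    first-resp : Respects First
    first-resp eq (tri , av , P) = isTriangle-resp eq tri , avoids-resp {S} eq av ,
      weaken (λ i x → subst (λ z → S i x ∨ does (z Fin.≟ x) ≡ false) (eq i)) P
    join : ∃ First → Packing S (suc m)
    join (t , tri , av , P) = extend tri av (weaken (λ i x → ∨-conicalˡ _ _) P)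
      λ s i → does-false⇒¬ (t i Fin.≟ member P s i) (∨-conicalʳ (S i (member P s i)) _ (avoids P s i))
    split : Packing S (suc m) → ∃ First
    split P = member P zero , triangle P zero , avoids P zero , record
      { member    = member P ∘ suc
      ; triangle  = triangle P ∘ suc
      ; avoids    = λ s i → cong₂ _∨_ (avoids P (suc s) i)
          (dec-false (_ Fin.≟ _) λ eq → Fin.0≢1+n (injective P i eq))
      ; injective = λ i eq → Fin.suc-injective (injective P i eq)
      }

-- Triangles that meet a maximal packing in a single vertex

abstract
  trichotomy : (i j l : Fin 3) → i ≢ j → i ≢ l → j ≢ l → ∀ h → h ≡ i ⊎ h ≡ j ⊎ h ≡ l
  trichotomy = from-yes (Fin.all? λ (i : Fin 3) → Fin.all? λ (j : Fin 3) → Fin.all? λ (l : Fin 3) →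
    ¬? (i Fin.≟ j) →-dec ¬? (i Fin.≟ l) →-dec ¬? (j Fin.≟ l) →-dec
    Fin.all? λ (h : Fin 3) → (h Fin.≟ i) ⊎-dec (h Fin.≟ j) ⊎-dec (h Fin.≟ l))

module Links {n : ℕ} (G : TripartiteGraph (λ _ → n)) where
  open TripartiteGraph G
  open Packings G
  open Packing

  module _ {S : Region} {m : ℕ} (maximal : ¬ Packing S (suc m)) (P : Packing S m) where

    -- The triangle meets the packing in exactly one vertex, that of member `s` in part `i`: `apart`
    -- handles the other parts, and `injective` of the packing the other members within part `i`.
    record Link (s : Fin m) (i : Fin 3) (t : Transversal) : Set where
      field
        tri   : IsTriangle t
        av    : Avoids S t
        at    : t i ≡ member P s i
        apart : ∀ j → j ≢ i → ∀ s′ → t j ≢ member P s′ j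
    open Link

    link? : ∀ s i → Dec (∃ (Link s i))
    link? s i = anyTransversal? link-resp λ t → map′
      (λ (a , b , c , d) → record { tri = a; av = b; at = c; apart = d })
      (λ L → tri L , av L , at L , apart L)
      (isTriangle? t ×-dec avoids? S t ×-dec (t i Fin.≟ member P s i) ×-dec
        Fin.all? λ j → ¬? (j Fin.≟ i) →-dec Fin.all? λ s′ → ¬? (t j Fin.≟ member P s′ j))
      where
      link-resp : Respects (Link s i)
      link-resp eq L = record
        { tri   = isTriangle-resp eq (tri L)
        ; av    = avoids-resp {S} eq (av L)
        ; at    = trans (sym (eq i)) (at L)
        ; apart = λ j j≢i s′ e → apart L j j≢i s′ (trans (eq j) e)
        }

    -- A link touches no member but `s`, so it can take the place of `s`.
    replace : ∀ {s j t} → Link s j t → Packing S m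
    replace {s} {j} {t} L = record
      { member    = new
      ; triangle  = new-triangle
      ; avoids    = new-avoids
      ; injective = new-injective
      }
      where
      new : Fin m → Transversal
      new s′ with s Fin.≟ s′
      ... | yes _ = t
      ... | no  _ = member P s′
      new-triangle : ∀ s′ → IsTriangle (new s′)
      new-triangle s′ with s Fin.≟ s′
      ... | yes _ = tri L
      ... | no  _ = triangle P s′
      new-avoids : ∀ s′ → Avoids S (new s′)
      new-avoids s′ with s Fin.≟ s′
      ... | yes _ = av L
      ... | no  _ = avoids P s′
      separate : ∀ i {s′} → s ≢ s′ → t i ≢ member P s′ i
      separate i s≢s′ eq with i Fin.≟ j
      ... | yes refl = s≢s′ (injective P i (trans (sym (at L)) eq))
      ... | no  i≢j  = apart L i i≢j _ eq
      new-injective : ∀ i {s₁ s₂} → new s₁ i ≡ new s₂ i → s₁ ≡ s₂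
      new-injective i {s₁} {s₂} eq with s Fin.≟ s₁ | s Fin.≟ s₂
      ... | yes p | yes q = trans (sym p) q
      ... | yes _ | no  q = ⊥-elim (separate i q eq)
      ... | no  p | yes _ = ⊥-elim (separate i p (sym eq))
      ... | no  _ | no  _ = injective P i eq

    -- Otherwise member s of the packing could be traded for the two disjoint triangles t and t′.
    agree : ∀ {s i j l t t′} → i ≢ j → i ≢ l → j ≢ l → Link s i t → Link s j t′ → t l ≡ t′ l
    agree {s} {i} {j} {l} {t} {t′} i≢j i≢l j≢l L L′ = decidable-stable (t l Fin.≟ t′ l) λ differ →
      maximal (extend (tri L) (av L) (replace L′) (disjoint differ))
      where
      disjoint : t l ≢ t′ l → ∀ s′ h → t h ≢ member (replace L′) s′ h
      disjoint differ s′ h eq with s Fin.≟ s′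
      disjoint differ s′ h eq | yes _ with trichotomy i j l i≢j i≢l j≢l h
      ... | inj₁ refl        = apart L′ h i≢j s (trans (sym eq) (at L))
      ... | inj₂ (inj₁ refl) = apart L h (i≢j ∘ sym) s (trans eq (at L′))
      ... | inj₂ (inj₂ refl) = differ eq
      disjoint differ s′ h eq | no s≢s′ with h Fin.≟ i
      ... | yes refl = s≢s′ (injective P h (trans (sym (at L)) eq))
      ... | no  h≢i  = apart L h h≢i s′ eq

    -- t″ with its vertex in part l replaced by t l is a triangle disjoint from the packing.
    three-links : ∀ {s i j l t t′ t″} → i ≢ j → i ≢ l → j ≢ l →
                  Link s i t → Link s j t′ → Link s l t″ → ⊥
    three-links {s} {i} {j} {l} {t} {t′} {t″} i≢j i≢l j≢l L L′ L″ =
      maximal (extend u-tri u-av P u-apart)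
      where
      u : Transversal
      u h with h Fin.≟ l
      ... | yes _ = t h
      ... | no  _ = t″ h
      -- By `agree`, t″ shares its vertex in part i with t′ and its vertex in part j with t, while t
      -- and t′ share the one in part l. So each required edge is already an edge of t′ or of t.
      to-l : ∀ h → h ≢ l → Adj (h , t″ h) (l , t l)
      to-l h h≢l with trichotomy i j l i≢j i≢l j≢l h
      ... | inj₁ refl = subst₂ (λ x y → Adj (i , x) (l , y))
              (agree j≢l (i≢j ∘ sym) (i≢l ∘ sym) L′ L″) (sym (agree i≢j i≢l j≢l L L′))
              (tri L′ i l i≢l)
      ... | inj₂ (inj₁ refl) = subst (λ x → Adj (j , x) (l , t l))
              (agree i≢l i≢j (j≢l ∘ sym) L L″) (tri L j l j≢l)
      ... | inj₂ (inj₂ h≡l) = ⊥-elim (h≢l h≡l)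
      u-tri : IsTriangle u
      u-tri h h′ h≢h′ with h Fin.≟ l | h′ Fin.≟ l
      ... | yes refl | yes refl = ⊥-elim (h≢h′ refl)
      ... | yes refl | no  h′≢l = symmetric (to-l h′ h′≢l)
      ... | no  h≢l  | yes refl = to-l h h≢l
      ... | no  _    | no  _    = tri L″ h h′ h≢h′
      u-av : Avoids S u
      u-av h with h Fin.≟ l
      ... | yes _ = av L h
      ... | no  _ = av L″ h
      u-apart : ∀ s′ h → u h ≢ member P s′ h
      u-apart s′ h eq with h Fin.≟ l
      ... | yes refl = apart L h (i≢l ∘ sym) s′ eq
      ... | no  h≢l  = apart L″ h h≢l s′ eq

    -- The triangles meeting the packing only in member s all use its vertex in part i (special),
    -- or all pass through z in part i and avoid that vertex (centred).
    data Class (s : Fin m) : Set where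
      special : ∀ i → (∀ j → j ≢ i → ¬ ∃ (Link s j)) → Class s
      centred : ∀ i z → ¬ ∃ (Link s i) → (∀ j → j ≢ i → ∀ {t} → Link s j t → t i ≡ z) → Class s

    -- Links at two parts exclude any at the third by `three-links`. A further link at one of the
    -- two is compared by `agree` with the given link at the other, so all pass through `t l`.
    two-links : ∀ {s} i j l {t t′} → i ≢ j → i ≢ l → j ≢ l → Link s i t → Link s j t′ → Class s
    two-links i j l {t} i≢j i≢l j≢l L L′ = centred l (t l)
      (λ (_ , L″) → three-links i≢j i≢l j≢l L L′ L″) through
      where
      through : ∀ h → h ≢ l → ∀ {u} → Link _ h u → u l ≡ t l
      through h h≢l Lᵤ with trichotomy i j l i≢j i≢l j≢l h
      ... | inj₁ refl = trans (agree i≢j i≢l j≢l Lᵤ L′) (sym (agree i≢j i≢l j≢l L L′))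
      ... | inj₂ (inj₁ refl) = sym (agree i≢j i≢l j≢l L Lᵤ)
      ... | inj₂ (inj₂ h≡l) = ⊥-elim (h≢l h≡l)

    classify : ∀ s → Class s
    classify s = by-links (link? s 0F) (link? s 1F) (link? s 2F)
      where
      by-links : Dec (∃ (Link s 0F)) → Dec (∃ (Link s 1F)) → Dec (∃ (Link s 2F)) → Class s
      by-links (yes (_ , L)) (yes (_ , L′)) _ = two-links 0F 1F 2F (λ ()) (λ ()) (λ ()) L L′
      by-links (yes (_ , L)) (no _) (yes (_ , L′)) = two-links 0F 2F 1F (λ ()) (λ ()) (λ ()) L L′
      by-links (no _) (yes (_ , L)) (yes (_ , L′)) = two-links 1F 2F 0F (λ ()) (λ ()) (λ ()) L L′
      by-links (yes _) (no ¬L₁) (no ¬L₂) = special 0F λ where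
        0F j≢0 → ⊥-elim (j≢0 refl)
        1F _ → ¬L₁
        2F _ → ¬L₂
      by-links (no ¬L₀) (yes _) (no ¬L₂) = special 1F λ where
        0F _ → ¬L₀
        1F j≢1 → ⊥-elim (j≢1 refl)
        2F _ → ¬L₂
      -- A member without any link also lands here, since `special` asks for nothing in its own
      -- part.
      by-links (no ¬L₀) (no ¬L₁) _ = special 2F λ where
        0F _ → ¬L₀
        1F _ → ¬L₁
        2F j≢2 → ⊥-elim (j≢2 refl)

    -- A small set of pairs whose removal destroys all triangles avoiding `S`

    module Deletion (class : ∀ s → Class s) (Q : ∀ i x → Packing (insert S i x) m) where

      isSpecial isCentred : ∀ {s} → Class s → Fin 3 → Bool
      isSpecial (special i _)     j = does (i Fin.≟ j)
      isSpecial (centred _ _ _ _) j = false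
      isCentred (special _ _)     j = false
      isCentred (centred i _ _ _) j = does (i Fin.≟ j)

      δ : ∀ {k} → Fin k → Fin k → ℕ
      δ x y = 𝟙 (does (x Fin.≟ y))

      -- Removing the pairs of positive weight destroys every triangle avoiding S.  A pair is cut
      -- if both vertices are ordinary members, if one is a special vertex and the other lies on
      -- a packing of size m avoiding it, or if it joins z to a vertex of a member centred at z.
      ordinary : Fin 3 → Fin n → ℕ
      ordinary i x = ∑ (allFin m) λ s → 𝟙 (not (isSpecial (class s) i)) * δ (member P s i) x

      cut : ∀ {s} → Class s → Fin 3 → Fin n → Fin 3 → Fin n → ℕ
      cut {s} (special h _) i x j y =
        δ h i * (δ (member P s i) x * ∑ (allFin m) λ s′ → δ (member (Q i x) s′ j) y)
      cut {s} (centred h z _ _) i x j y = δ h i * (δ z x * δ (member P s j) y)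

      cuts : Fin 3 → Fin n → Fin 3 → Fin n → ℕ
      cuts i x j y = ∑ (allFin m) λ s → cut (class s) i x j y

      weight : Fin 3 → Fin n → Fin 3 → Fin n → ℕ
      weight i x j y = ordinary i x * ordinary j y + (cuts i x j y + cuts j y i x)

      private
        1≤δ : ∀ {k} {x y : Fin k} → x ≡ y → 1 ≤ δ x y
        1≤δ {x = x} {y} eq rewrite dec-true (x Fin.≟ y) eq = ≤-refl

        1≤* : ∀ {a b} → 1 ≤ a → 1 ≤ b → 1 ≤ a * b
        1≤* = *-mono-≤

        1≰0 : ∀ {a} → 1 ≤ a → a ≢ 0
        1≰0 (s≤s _) ()

        1≤∑ : (f : Fin m → ℕ) → ∀ s → 1 ≤ f s → 1 ≤ ∑ (allFin m) f
        1≤∑ f s p = ≤-trans p (∈⇒≤∑ f (∈-allFin s))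

      module _ {t : Transversal} (t-tri : IsTriangle t) (t-av : Avoids S t)
               (uncut : ∀ i j → i ≢ j → weight i (t i) j (t j) ≡ 0) where
        private
          no-cut : ∀ s i j → i ≢ j → cut (class s) i (t i) j (t j) ≡ 0
          no-cut s i j i≢j with cut (class s) i (t i) j (t j) in eq
          ... | zero = refl
          ... | suc _ = ⊥-elim (1≰0 (1≤∑ (λ s → cut (class s) i (t i) j (t j)) s
                  (subst (1 ≤_) (sym eq) (s≤s z≤n)))
                (m+n≡0⇒m≡0 _ (m+n≡0⇒n≡0 (ordinary i (t i) * ordinary j (t j)) (uncut i j i≢j))))

          -- If `t i` were special, the vanishing cuts would keep `t` off `Q i (t i)` in the other
          -- two parts, and that packing avoids `t i` itself. Adding `t` would then give m + 1
          -- disjoint triangles.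
          not-special : ∀ {s} (c : Class s) i → (∀ j → i ≢ j → cut c i (t i) j (t j) ≡ 0) →
                        t i ≡ member P s i → isSpecial c i ≡ false
          not-special (centred _ _ _ _) _ _ _ = refl
          not-special {s} (special h _) i none at with h Fin.≟ i in h≟i
          ... | no _ = refl
          ... | yes refl = ⊥-elim (maximal (extend t-tri t-av
                  (weaken (λ j x → ∨-conicalˡ _ _) (Q i (t i))) disjoint))
            where
            disjoint : ∀ s′ j → t j ≢ member (Q i (t i)) s′ j
            disjoint s′ j eq with i Fin.≟ j
            ... | no i≢j = 1≰0 (1≤* {1} ≤-refl (1≤* (1≤δ (sym at))
                    (1≤∑ (λ s′ → δ (member (Q i (t i)) s′ j) (t j)) s′ (1≤δ (sym eq)))))
                    (none j i≢j)
            ... | yes refl = insert-misses {S} i (avoids (Q i (t i)) s′ i) eq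

          ordinary-pos : ∀ {s i} → t i ≡ member P s i → 1 ≤ ordinary i (t i)
          ordinary-pos {s} {i} at = 1≤∑ (λ s → 𝟙 (not (isSpecial (class s) i)) * δ (member P s i) (t i)) s
            (1≤* (subst (λ b → 1 ≤ 𝟙 (not b)) (sym (not-special (class s) i (λ j → no-cut s i j) at)) ≤-refl)
                 (1≤δ (sym at)))

          -- In the special case links occur only at the special vertex. In the centred case the
          -- link contains z and a vertex of member `s`, and that pair is cut.
          refute : ∀ {s i} (c : Class s) → Link s i t → isSpecial c i ≡ false →
                   (∀ j → j ≢ i → cut c j (t j) i (t i) ≡ 0) → ⊥
          refute {i = i} (special h only) L sp _ =
            only i (λ i≡h → does-false⇒¬ (h Fin.≟ i) sp (sym i≡h)) (t , L)
          refute {s} {i} (centred h z none through) L _ uncut′ with h Fin.≟ i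
          ... | yes refl = none (t , L)
          ... | no  h≢i  = 1≰0 (1≤* (1≤δ {x = h} refl) (1≤* (1≤δ (sym (through i (h≢i ∘ sym) L))) (1≤δ (sym (at L)))))
                               (uncut′ h h≢i)

        -- By maximality `t` meets the packing. Its vertices there are ordinary, and two of them
        -- would have positive weight together, so there is only one: `t` is a link, which `refute`
        -- excludes.
        uncut⇒⊥ : ⊥
        uncut⇒⊥ with Fin.any? (λ i → Fin.any? λ s → t i Fin.≟ member P s i)
        ... | no  none = maximal (extend t-tri t-av P λ s i eq → none (i , s , eq))
        ... | yes (i , s , eq) = refute (class s) link
                (not-special (class s) i (λ j → no-cut s i j) eq) (λ j j≢i → no-cut s j i j≢i)
          where
          link : Link s i t
          link = record
            { tri = t-tri ; av = t-av ; at = eq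
            ; apart = λ j j≢i s′ eq′ → 1≰0 (1≤* (ordinary-pos eq) (ordinary-pos eq′))
                (m+n≡0⇒m≡0 _ (uncut i j (j≢i ∘ sym))) }

      specials ordinaries centres : Fin 3 → ℕ
      specials   i = ∑ (allFin m) λ s → 𝟙 (isSpecial (class s) i)
      ordinaries i = ∑ (allFin m) λ s → 𝟙 (not (isSpecial (class s) i))
      centres    i = ∑ (allFin m) λ s → 𝟙 (isCentred (class s) i)

      -- A special vertex accounts for at most `m` pairs with a given other part, where its packing
      -- `Q` has `m` vertices; a centre accounts for one, with its own member.
      deleted : Fin 3 → Fin 3 → ℕ
      deleted i j = ordinaries i * ordinaries j
                  + ((specials i * m + centres i) + (specials j * m + centres j))

      ordinaries+specials : ∀ i → ordinaries i + specials i ≡ m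
      ordinaries+specials i = trans (sym (∑-+ (allFin m) _ _))
        (trans (∑-cong (allFin m) λ s → 𝟙-not (isSpecial (class s) i)) (∑-allFin-1 m))

      -- Each class names exactly one part, so specials and centres compete for the `m` members;
      -- this is the budget in `deletion-count`.
      specials+centres : (specials 0F + specials 1F + specials 2F)
                       + (centres 0F + centres 1F + centres 2F) ≡ m
      specials+centres = begin
        (specials 0F + specials 1F + specials 2F) + (centres 0F + centres 1F + centres 2F)
          ≡⟨ cong₂ _+_ (three isSpecial) (three isCentred) ⟨
        ∑ (allFin m) (λ s → all isSpecial s) + ∑ (allFin m) (λ s → all isCentred s)
          ≡⟨ ∑-+ (allFin m) _ _ ⟨
        ∑ (allFin m) (λ s → all isSpecial s + all isCentred s)
          ≡⟨ ∑-cong (allFin m) (λ s → one (class s)) ⟩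
        ∑ (allFin m) (λ _ → 1)
          ≡⟨ ∑-allFin-1 m ⟩
        m ∎
        where
        open ≡-Reasoning
        all : (∀ {s} → Class s → Fin 3 → Bool) → Fin m → ℕ
        all f s = 𝟙 (f (class s) 0F) + 𝟙 (f (class s) 1F) + 𝟙 (f (class s) 2F)
        three : ∀ (f : ∀ {s} → Class s → Fin 3 → Bool) → ∑ (allFin m) (all f)
          ≡ ∑ (allFin m) (λ s → 𝟙 (f (class s) 0F)) + ∑ (allFin m) (λ s → 𝟙 (f (class s) 1F))
            + ∑ (allFin m) (λ s → 𝟙 (f (class s) 2F))
        three f = trans (∑-+ (allFin m) _ _)
          (cong (λ z → z + ∑ (allFin m) (λ s → 𝟙 (f (class s) 2F))) (∑-+ (allFin m) _ _))
        one : ∀ {s} (c : Class s) →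
          (𝟙 (isSpecial c 0F) + 𝟙 (isSpecial c 1F) + 𝟙 (isSpecial c 2F))
          + (𝟙 (isCentred c 0F) + 𝟙 (isCentred c 1F) + 𝟙 (isCentred c 2F)) ≡ 1
        one (special 0F _)     = refl
        one (special 1F _)     = refl
        one (special 2F _)     = refl
        one (centred 0F _ _ _) = refl
        one (centred 1F _ _ _) = refl
        one (centred 2F _ _ _) = refl

      ∑∑ : (Fin n → Fin n → ℕ) → ℕ
      ∑∑ f = ∑ (allFin n) λ x → ∑ (allFin n) (f x)

      private
        ∑-δ*≤ : ∀ {k} (z : Fin k) c → ∑ (allFin k) (λ x → c * δ z x) ≤ c
        ∑-δ*≤ z c = ≤-trans (≤-reflexive (∑-*ˡ (allFin _) c (δ z)))
          (≤-trans (*-monoʳ-≤ c (∑-δ z)) (≤-reflexive (*-identityʳ c)))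

        ∑-ordinary : ∀ i → ∑ (allFin n) (ordinary i) ≤ ordinaries i
        ∑-ordinary i = ≤-trans (≤-reflexive (∑-swap (allFin n) (allFin m) _))
          (∑-mono (allFin m) λ s → ∑-δ*≤ (member P s i) (𝟙 (not (isSpecial (class s) i))))

        ∑∑-cut : ∀ {s} (c : Class s) i j →
          ∑∑ (λ x y → cut c i x j y) ≤ 𝟙 (isSpecial c i) * m + 𝟙 (isCentred c i)
        ∑∑-cut {s} (special h _) i j = begin
          ∑∑ (λ x y → cut-at x y)
            ≤⟨ ∑-mono (allFin n) row ⟩
          ∑ (allFin n) (λ x → δ h i * m * δ (member P s i) x)
            ≤⟨ ∑-δ*≤ (member P s i) (δ h i * m) ⟩
          δ h i * m
            ≡⟨ +-identityʳ _ ⟨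
          δ h i * m + 0 ∎
          where
          open ≤-Reasoning
          cut-at : Fin n → Fin n → ℕ
          cut-at x y = δ h i * (δ (member P s i) x * ∑ (allFin m) λ s′ → δ (member (Q i x) s′ j) y)
          row : ∀ x → ∑ (allFin n) (cut-at x) ≤ δ h i * m * δ (member P s i) x
          row x = begin
            ∑ (allFin n) (cut-at x)
              ≡⟨ ∑-*ˡ (allFin n) (δ h i) _ ⟩
            δ h i * ∑ (allFin n) (λ y → δ (member P s i) x * ∑ (allFin m) λ s′ → δ (member (Q i x) s′ j) y)
              ≡⟨ cong (δ h i *_) (∑-*ˡ (allFin n) (δ (member P s i) x) _) ⟩
            δ h i * (δ (member P s i) x * ∑ (allFin n) (λ y → ∑ (allFin m) λ s′ → δ (member (Q i x) s′ j) y))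
              ≡⟨ cong (λ z → δ h i * (δ (member P s i) x * z)) (∑-swap (allFin n) (allFin m) _) ⟩
            δ h i * (δ (member P s i) x * ∑ (allFin m) (λ s′ → ∑ (allFin n) (δ (member (Q i x) s′ j))))
              ≤⟨ *-monoʳ-≤ (δ h i) (*-monoʳ-≤ (δ (member P s i) x)
                   (∑-mono (allFin m) λ s′ → ∑-δ (member (Q i x) s′ j))) ⟩
            δ h i * (δ (member P s i) x * ∑ (allFin m) (λ _ → 1))
              ≡⟨ cong (λ z → δ h i * (δ (member P s i) x * z)) (∑-allFin-1 m) ⟩
            δ h i * (δ (member P s i) x * m)
              ≡⟨ cong (δ h i *_) (*-comm (δ (member P s i) x) m) ⟩
            δ h i * (m * δ (member P s i) x)
              ≡⟨ *-assoc (δ h i) m _ ⟨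
            δ h i * m * δ (member P s i) x ∎
        ∑∑-cut {s} (centred h z _ _) i j = begin
          ∑∑ (λ x y → δ h i * (δ z x * δ (member P s j) y))
            ≡⟨ ∑-cong (allFin n) (λ x → ∑-*ˡ (allFin n) (δ h i) _) ⟩
          ∑ (allFin n) (λ x → δ h i * ∑ (allFin n) (λ y → δ z x * δ (member P s j) y))
            ≡⟨ ∑-*ˡ (allFin n) (δ h i) _ ⟩
          δ h i * ∑∑ (λ x y → δ z x * δ (member P s j) y)
            ≡⟨ cong (δ h i *_) (∑-* (allFin n) (allFin n) (δ z) (δ (member P s j))) ⟩
          δ h i * (∑ (allFin n) (δ z) * ∑ (allFin n) (δ (member P s j)))
            ≤⟨ *-monoʳ-≤ (δ h i) (*-mono-≤ (∑-δ z) (∑-δ (member P s j))) ⟩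
          δ h i * 1
            ≡⟨ *-identityʳ (δ h i) ⟩
          δ h i ∎
          where open ≤-Reasoning

        ∑∑-cuts : ∀ i j → ∑∑ (λ x y → cuts i x j y) ≤ specials i * m + centres i
        ∑∑-cuts i j = begin
          ∑∑ (λ x y → cuts i x j y)
            ≡⟨ ∑-cong (allFin n) (λ x → ∑-swap (allFin n) (allFin m) _) ⟩
          ∑ (allFin n) (λ x → ∑ (allFin m) λ s → ∑ (allFin n) λ y → cut (class s) i x j y)
            ≡⟨ ∑-swap (allFin n) (allFin m) _ ⟩
          ∑ (allFin m) (λ s → ∑∑ λ x y → cut (class s) i x j y)
            ≤⟨ ∑-mono (allFin m) (λ s → ∑∑-cut (class s) i j) ⟩
          ∑ (allFin m) (λ s → 𝟙 (isSpecial (class s) i) * m + 𝟙 (isCentred (class s) i))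
            ≡⟨ ∑-+ (allFin m) _ _ ⟩
          ∑ (allFin m) (λ s → 𝟙 (isSpecial (class s) i) * m) + centres i
            ≡⟨ cong (_+ centres i) (∑-*ʳ (allFin m) _ m) ⟩
          specials i * m + centres i ∎
          where open ≤-Reasoning

      ∑∑-weight : ∀ i j → ∑∑ (λ x y → weight i x j y) ≤ deleted i j
      ∑∑-weight i j = begin
        ∑∑ (λ x y → weight i x j y)
          ≡⟨ ∑∑-+ _ _ ⟩
        ∑∑ (λ x y → ordinary i x * ordinary j y) + ∑∑ (λ x y → cuts i x j y + cuts j y i x)
          ≡⟨ cong₂ _+_ (∑-* (allFin n) (allFin n) (ordinary i) (ordinary j)) (∑∑-+ _ _) ⟩
        ∑ (allFin n) (ordinary i) * ∑ (allFin n) (ordinary j)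
          + (∑∑ (λ x y → cuts i x j y) + ∑∑ (λ x y → cuts j y i x))
          ≤⟨ +-mono-≤ (*-mono-≤ (∑-ordinary i) (∑-ordinary j)) (+-mono-≤ (∑∑-cuts i j)
               (≤-trans (≤-reflexive (∑-swap (allFin n) (allFin n) _)) (∑∑-cuts j i))) ⟩
        deleted i j ∎
        where
        open ≤-Reasoning
        ∑∑-+ : ∀ f g → ∑∑ (λ x y → f x y + g x y) ≡ ∑∑ f + ∑∑ g
        ∑∑-+ f g = trans (∑-cong (allFin n) λ x → ∑-+ (allFin n) (f x) (g x)) (∑-+ (allFin n) _ _)

-- Counting the surviving edges

does-true⇒ : ∀ {A : Set} (a? : Dec A) → does a? ≡ true → A
does-true⇒ (yes a) _ = a

∧-true : ∀ {a b} → a ∧ b ≡ true → a ≡ true × b ≡ true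
∧-true {true} {true} _ = refl , refl

not-true : ∀ {b} → not b ≡ true → b ≡ false
not-true {false} _ = refl

length-filter-cartesianProduct : ∀ {A B : Set} {R : A × B → Set} (R? : ∀ p → Dec (R p)) xs ys →
  length (filter R? (cartesianProduct xs ys)) ≡ ∑ xs λ x → ∑ ys λ y → 𝟙 (does (R? (x , y)))
length-filter-cartesianProduct R? [] ys = refl
length-filter-cartesianProduct {A} {B} R? (x ∷ xs) ys = begin
  length (filter R? (map (x ,_) ys ++ cartesianProduct xs ys))
    ≡⟨ cong length (filter-++ R? (map (x ,_) ys) (cartesianProduct xs ys)) ⟩
  length (filter R? (map (x ,_) ys) ++ filter R? (cartesianProduct xs ys))
    ≡⟨ length-++ (filter R? (map (x ,_) ys)) ⟩
  length (filter R? (map (x ,_) ys)) + length (filter R? (cartesianProduct xs ys))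
    ≡⟨ cong₂ _+_ (row ys) (length-filter-cartesianProduct R? xs ys) ⟩
  ∑ ys (λ y → 𝟙 (does (R? (x , y)))) + ∑ xs (λ x → ∑ ys λ y → 𝟙 (does (R? (x , y)))) ∎
  where
  open ≡-Reasoning
  row : ∀ ys → length (filter R? (map (x ,_) ys)) ≡ ∑ ys λ y → 𝟙 (does (R? (x , y)))
  row [] = refl
  row (y ∷ ys) with does (R? (x , y))
  ... | true  = cong suc (row ys)
  ... | false = row ys

open DensityBounds

∸-from-+ : ∀ a b {n} → a + b ≡ n → ℤ.+ a ≡ ℤ.+ n ℤ.- ℤ.+ b
∸-from-+ a b refl = eq (ℤ.+ a) (ℤ.+ b)
  where
  eq : ∀ x y → x ≡ x ℤ.+ y ℤ.- y
  eq = solve-∀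

deletions : (m : ℕ) (o a c : Fin 3 → ℕ) → Fin 3 → Fin 3 → ℕ
deletions m o a c h h′ = o h * o h′ + ((a h * m + c h) + (a h′ * m + c h′))

density-conditions-ℕ : ∀ n K e p q w i j l m (o a c : Fin 3 → ℕ) X Y Z →
  let E = deletions m o a c in
  5 * K + 7 ≤ n →
  0ℤ ℤ.< ℤ.+ e ℤ.* ℤ.+ e ℤ.+ ℤ.+ n ℤ.* (ℤ.+ n ℤ.- ℤ.+ K) ℤ.* ℤ.+ e
         ℤ.- ℤ.+ n ℤ.* ℤ.+ n ℤ.* (ℤ.+ n ℤ.* ℤ.+ n) →
  0ℤ ℤ.≤ ℤ.+ n ℤ.* (ℤ.+ n ℤ.- ℤ.+ K) ℤ.- ℤ.+ e →
  p + i ≡ n → q + j ≡ n → w + l ≡ n → i + j + l + m ≤ K →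
  (∀ h → o h + a h ≡ m) → (a 0F + a 1F + a 2F) + (c 0F + c 1F + c 2F) ≡ m →
  p * q + e ≤ X + E 0F 1F + n * n → p * w + e ≤ Y + E 0F 2F + n * n →
  q * w + e ≤ Z + E 1F 2F + n * n →
  0ℤ ℤ.< ℤ.+ X ℤ.* ℤ.+ Y ℤ.- ℤ.+ p ℤ.* ℤ.+ p ℤ.* (ℤ.+ q ℤ.* ℤ.+ w ℤ.- ℤ.+ Z) ×
  0ℤ ℤ.< ℤ.+ X ℤ.* ℤ.+ Z ℤ.- ℤ.+ q ℤ.* ℤ.+ q ℤ.* (ℤ.+ p ℤ.* ℤ.+ w ℤ.- ℤ.+ Y) ×
  0ℤ ℤ.< ℤ.+ Y ℤ.* ℤ.+ Z ℤ.- ℤ.+ w ℤ.* ℤ.+ w ℤ.* (ℤ.+ p ℤ.* ℤ.+ q ℤ.- ℤ.+ X)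
density-conditions-ℕ n K e p q w i j l m o a c X Y Z n≥ dense cap pi qj wl R oa ac hX hY hZ =
  density-conditions (ℤ.+ n) (ℤ.+ K) (ℤ.+ e) (0≤ K) (0≤ e) n≥ℤ dense cap
    (ℤ.+ i) (ℤ.+ j) (ℤ.+ l) (ℤ.+ m) (ℤ.+ E 0F 1F) (ℤ.+ E 0F 2F) (ℤ.+ E 1F 2F)
    (ℤ.+ X) (ℤ.+ Y) (ℤ.+ Z) (0≤ i) (0≤ j) (0≤ l) (0≤ m) (ℤ.i≤j⇒0≤j-i (+≤+ R))
    (0≤ (E 0F 1F)) (0≤ (E 0F 2F)) (0≤ (E 1F 2F)) E≤
    (∸-from-+ p i pi) (∸-from-+ q j qj) (∸-from-+ w l wl) (count p q X (E 0F 1F) hX) (count p w Y (E 0F 2F) hY)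
    (count q w Z (E 1F 2F) hZ)
  where
  E : Fin 3 → Fin 3 → ℕ
  E = deletions m o a c
  0≤ : ∀ k → 0ℤ ℤ.≤ ℤ.+ k
  0≤ k = +≤+ z≤n
  n≥ℤ : 0ℤ ℤ.≤ ℤ.+ n ℤ.- (ℤ.+ 5 ℤ.* ℤ.+ K ℤ.+ ℤ.+ 7)
  n≥ℤ = 0≤-by (ℤ.i≤j⇒0≤j-i (+≤+ n≥)) (cong (λ z → ℤ.+ n ℤ.- (z ℤ.+ ℤ.+ 7)) (ℤ.pos-* 5 K))
  count : ∀ p q X D → p * q + e ≤ X + D + n * n →
    0ℤ ℤ.≤ ℤ.+ X ℤ.+ ℤ.+ D ℤ.+ (ℤ.+ n ℤ.* ℤ.+ n ℤ.- ℤ.+ e) ℤ.- ℤ.+ p ℤ.* ℤ.+ q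
  count p q X D h = 0≤-by (ℤ.i≤j⇒0≤j-i (+≤+ h))
    (trans (cong₂ (λ x y → ℤ.+ X ℤ.+ ℤ.+ D ℤ.+ x ℤ.- (y ℤ.+ ℤ.+ e)) (ℤ.pos-* n n) (ℤ.pos-* p q))
           (eq (ℤ.+ X) (ℤ.+ D) (ℤ.+ n) (ℤ.+ e) (ℤ.+ p) (ℤ.+ q)))
    where
    eq : ∀ X D n e p q → X ℤ.+ D ℤ.+ n ℤ.* n ℤ.- (p ℤ.* q ℤ.+ e) ≡ X ℤ.+ D ℤ.+ (n ℤ.* n ℤ.- e) ℤ.- p ℤ.* q
    eq = solve-∀
  E-cast : ∀ h h′ → (ℤ.+ m ℤ.- ℤ.+ a h) ℤ.* (ℤ.+ m ℤ.- ℤ.+ a h′)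
    ℤ.+ ((ℤ.+ a h ℤ.* ℤ.+ m ℤ.+ ℤ.+ c h) ℤ.+ (ℤ.+ a h′ ℤ.* ℤ.+ m ℤ.+ ℤ.+ c h′)) ≡ ℤ.+ E h h′
  E-cast h h′ = cong₂ ℤ._+_
    (trans (sym (cong₂ ℤ._*_ (∸-from-+ (o h) (a h) (oa h)) (∸-from-+ (o h′) (a h′) (oa h′)))) (sym (ℤ.pos-* (o h) (o h′))))
    (cong₂ ℤ._+_ (cong (λ z → z ℤ.+ ℤ.+ c h) (sym (ℤ.pos-* (a h) m)))
                 (cong (λ z → z ℤ.+ ℤ.+ c h′) (sym (ℤ.pos-* (a h′) m))))
  E≤ : 0ℤ ℤ.≤ ℤ.+ 10 ℤ.* (ℤ.+ m ℤ.* ℤ.+ m) ℤ.+ ℤ.+ 6 ℤ.* ℤ.+ m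
    ℤ.- ℤ.+ 3 ℤ.* (ℤ.+ E 0F 1F ℤ.+ ℤ.+ E 0F 2F ℤ.+ ℤ.+ E 1F 2F)
  E≤ = 0≤-by
    (deletion-count (ℤ.+ m) (ℤ.+ a 0F) (ℤ.+ a 1F) (ℤ.+ a 2F) (ℤ.+ c 0F) (ℤ.+ c 1F) (ℤ.+ c 2F)
      (0≤ (a 0F)) (0≤ (a 1F)) (0≤ (a 2F)) (0≤ (c 0F)) (0≤ (c 1F)) (0≤ (c 2F))
      (ℤ.i≤j⇒0≤j-i (+≤+ (≤-reflexive ac))))
    (cong (λ z → ℤ.+ 10 ℤ.* (ℤ.+ m ℤ.* ℤ.+ m) ℤ.+ ℤ.+ 6 ℤ.* ℤ.+ m ℤ.- ℤ.+ 3 ℤ.* z)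
      (cong₂ ℤ._+_ (cong₂ ℤ._+_ (E-cast 0F 1F) (E-cast 0F 2F)) (E-cast 1F 2F)))

module Counting {n : ℕ} (G : TripartiteGraph (λ _ → n)) where
  open TripartiteGraph G
  open Packings G
  open Packing
  open Links G

  count : Region → Fin 3 → ℕ
  count S i = ∑ (allFin n) (𝟙 ∘ S i)

  total : Region → ℕ
  total S = count S 0F + count S 1F + count S 2F

  part : Region → Fin 3 → List (Fin n)
  part S i = filterᵇ (not ∘ S i) (allFin n)

  length-part : ∀ S i → length (part S i) + count S i ≡ n
  length-part S i = begin
    length (part S i) + count S i                   ≡⟨ cong (_+ count S i) (length-filter (not ∘ S i) (allFin n)) ⟩
    ∑ (allFin n) (𝟙 ∘ not ∘ S i) + count S i        ≡⟨ ∑-+ (allFin n) _ _ ⟨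
    ∑ (allFin n) (λ x → 𝟙 (not (S i x)) + 𝟙 (S i x)) ≡⟨ ∑-cong (allFin n) (λ x → 𝟙-not (S i x)) ⟩
    ∑ (allFin n) (λ _ → 1)                          ≡⟨ ∑-allFin-1 n ⟩
    n                                               ∎
    where open ≡-Reasoning

  total-insert : ∀ S i x → total (insert S i x) ≤ suc (total S)
  total-insert S i x = begin
    total (insert S i x)
      ≤⟨ +-mono-≤ (+-mono-≤ (count-insert 0F) (count-insert 1F)) (count-insert 2F) ⟩
    count S 0F + at 0F + (count S 1F + at 1F) + (count S 2F + at 2F)
      ≡⟨ cong (_+ (count S 2F + at 2F)) (interchange +-commutativeSemigroup (count S 0F) _ _ _) ⟩
    count S 0F + count S 1F + (at 0F + at 1F) + (count S 2F + at 2F)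
      ≡⟨ interchange +-commutativeSemigroup (count S 0F + count S 1F) _ _ _ ⟩
    total S + (at 0F + at 1F + at 2F)
      ≡⟨ cong (total S +_) (once i) ⟩
    total S + 1
      ≡⟨ +-comm (total S) 1 ⟩
    suc (total S) ∎
    where
    open ≤-Reasoning
    at : Fin 3 → ℕ
    at j = 𝟙 (does (i Fin.≟ j))
    once : ∀ i → 𝟙 (does (i Fin.≟ 0F)) + 𝟙 (does (i Fin.≟ 1F)) + 𝟙 (does (i Fin.≟ 2F)) ≡ 1
    once 0F = refl
    once 1F = refl
    once 2F = refl
    𝟙-∨ : ∀ a b c → 𝟙 (a ∨ (b ∧ c)) ≤ 𝟙 a + 𝟙 b * 𝟙 c
    𝟙-∨ true  _     _     = s≤s z≤n
    𝟙-∨ false true  true  = ≤-refl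
    𝟙-∨ false true  false = z≤n
    𝟙-∨ false false _     = z≤n
    count-insert : ∀ j → count (insert S i x) j ≤ count S j + at j
    count-insert j = begin
      count (insert S i x) j
        ≤⟨ ∑-mono (allFin n) (λ y → 𝟙-∨ (S j y) (does (i Fin.≟ j)) (does (x Fin.≟ y))) ⟩
      ∑ (allFin n) (λ y → 𝟙 (S j y) + at j * 𝟙 (does (x Fin.≟ y)))
        ≡⟨ ∑-+ (allFin n) _ _ ⟩
      count S j + ∑ (allFin n) (λ y → at j * 𝟙 (does (x Fin.≟ y)))
        ≡⟨ cong (count S j +_) (∑-*ˡ (allFin n) (at j) _) ⟩
      count S j + at j * ∑ (allFin n) (λ y → 𝟙 (does (x Fin.≟ y)))
        ≤⟨ +-monoʳ-≤ (count S j) (*-monoʳ-≤ (at j) (∑-δ x)) ⟩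
      count S j + at j * 1
        ≡⟨ cong (count S j +_) (*-identityʳ (at j)) ⟩
      count S j + at j ∎

  adjacent : (i j : Fin 3) → Fin n → Fin n → Bool
  adjacent i j x y = does (adj? (i , x) (j , y))

  module _ {S : Region} {m : ℕ} (maximal : ¬ Packing S (suc m)) (P : Packing S m)
           (class : ∀ s → Class maximal P s) (Q : ∀ i x → Packing (insert S i x) m) where
    open Deletion maximal P class Q

    kept : (i j : Fin 3) → Fin n → Fin n → Bool
    kept i j x y = adjacent i j x y ∧ (does (weight i x j y ≟ 0) ∧ (not (S i x) ∧ not (S j y)))

    kept⇒ : ∀ i j {x y} → kept i j x y ≡ true →
      Adj (i , x) (j , y) × weight i x j y ≡ 0 × S i x ≡ false × S j y ≡ false
    kept⇒ i j {x} {y} k =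
      let k₁ , k′ = ∧-true k
          k₂ , k″ = ∧-true k′
          k₃ , k₄ = ∧-true k″
      in does-true⇒ (adj? (i , x) (j , y)) k₁ , does-true⇒ (weight i x j y ≟ 0) k₂ , not-true k₃ , not-true k₄

    weight-sym : ∀ i j x y → weight i x j y ≡ weight j y i x
    weight-sym i j x y = cong₂ _+_ (*-comm (ordinary i x) (ordinary j y)) (+-comm (cuts i x j y) (cuts j y i x))

    kept-triangle-free : ∀ a b c →
      kept 0F 1F a b ≡ true → kept 0F 2F a c ≡ true → kept 1F 2F b c ≡ true → ⊥
    kept-triangle-free a b c k₀₁ k₀₂ k₁₂
      with ab , w₀₁ , Sa , Sb ← kept⇒ 0F 1F k₀₁
         | ac , w₀₂ , _  , Sc ← kept⇒ 0F 2F k₀₂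
         | bc , w₁₂ , _  , _  ← kept⇒ 1F 2F k₁₂
      = uncut⇒⊥ {t} tri av uncut
      where
      t : Transversal
      t 0F = a
      t 1F = b
      t 2F = c
      tri : IsTriangle t
      tri 0F 0F i≢i = ⊥-elim (i≢i refl)
      tri 0F 1F _   = ab
      tri 0F 2F _   = ac
      tri 1F 0F _   = symmetric ab
      tri 1F 1F i≢i = ⊥-elim (i≢i refl)
      tri 1F 2F _   = bc
      tri 2F 0F _   = symmetric ac
      tri 2F 1F _   = symmetric bc
      tri 2F 2F i≢i = ⊥-elim (i≢i refl)
      av : Avoids S t
      av 0F = Sa
      av 1F = Sb
      av 2F = Sc
      uncut : ∀ i j → i ≢ j → weight i (t i) j (t j) ≡ 0
      uncut 0F 0F i≢i = ⊥-elim (i≢i refl)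
      uncut 0F 1F _   = w₀₁
      uncut 0F 2F _   = w₀₂
      uncut 1F 0F _   = trans (weight-sym 1F 0F b a) w₀₁
      uncut 1F 1F i≢i = ⊥-elim (i≢i refl)
      uncut 1F 2F _   = w₁₂
      uncut 2F 0F _   = trans (weight-sym 2F 0F c a) w₀₂
      uncut 2F 1F _   = trans (weight-sym 2F 1F c b) w₁₂
      uncut 2F 2F i≢i = ⊥-elim (i≢i refl)

    keptCount : Fin 3 → Fin 3 → ℕ
    keptCount i j = ∑ (part S i) λ x → ∑ (part S j) (𝟙 ∘ kept i j x)

    -- A pair outside `S` is kept, nonadjacent, or of positive weight. Nonadjacent pairs are counted
    -- over both whole parts, where there are at most n² - e of them; `e` stands on the left to
    -- avoid truncated subtraction.
    keptCount-≥ : ∀ {e} i j → e ≤ length (edges G i j) →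
      length (part S i) * length (part S j) + e ≤ keptCount i j + deleted i j + n * n
    keptCount-≥ {e} i j e≤ = begin
      length (part S i) * length (part S j) + e
        ≡⟨ cong (_+ e) (trans (∑-* (part S i) (part S j) (λ _ → 1) (λ _ → 1))
             (cong₂ _*_ (∑-1 (part S i)) (∑-1 (part S j)))) ⟨
      ∑ (part S i) (λ x → ∑ (part S j) λ y → 1) + e
        ≤⟨ +-monoˡ-≤ e (∑-mono-∈ (part S i) λ x∈ → ∑-mono-∈ (part S j) λ y∈ →
             pointwise (∈-filterᵇ (not ∘ S i) (allFin n) x∈) (∈-filterᵇ (not ∘ S j) (allFin n) y∈)) ⟩
      ∑ (part S i) (λ x → ∑ (part S j) λ y → 𝟙 (kept i j x y) + lost x y) + e
        ≡⟨ cong (_+ e) (trans (∑-cong (part S i) λ x → ∑-+ (part S j) _ _) (∑-+ (part S i) _ _)) ⟩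
      keptCount i j + ∑ (part S i) (λ x → ∑ (part S j) (lost x)) + e
        ≤⟨ +-monoˡ-≤ e (+-monoʳ-≤ (keptCount i j) (≤-trans
             (∑-filter-≤ (not ∘ S i) (allFin n) _)
             (∑-mono (allFin n) λ x → ∑-filter-≤ (not ∘ S j) (allFin n) (lost x)))) ⟩
      keptCount i j + ∑∑ lost + e
        ≡⟨ cong (λ z → keptCount i j + z + e) (trans
             (∑-cong (allFin n) λ x → ∑-+ (allFin n) _ _) (∑-+ (allFin n) _ _)) ⟩
      keptCount i j + (nonedges + ∑∑ (λ x y → weight i x j y)) + e
        ≤⟨ +-monoˡ-≤ e (+-monoʳ-≤ (keptCount i j) (+-monoʳ-≤ nonedges (∑∑-weight i j))) ⟩
      keptCount i j + (nonedges + deleted i j) + e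
        ≡⟨ rearrange (keptCount i j) nonedges (deleted i j) e ⟩
      keptCount i j + deleted i j + (nonedges + e)
        ≤⟨ +-monoʳ-≤ (keptCount i j + deleted i j) (≤-trans (+-monoʳ-≤ nonedges e≤) (≤-reflexive all)) ⟩
      keptCount i j + deleted i j + n * n ∎
      where
      open ≤-Reasoning
      lost : Fin n → Fin n → ℕ
      lost x y = 𝟙 (not (adjacent i j x y)) + weight i x j y
      nonedges : ℕ
      nonedges = ∑∑ λ x y → 𝟙 (not (adjacent i j x y))
      pointwise : ∀ {x y} → not (S i x) ≡ true → not (S j y) ≡ true → 1 ≤ 𝟙 (kept i j x y) + lost x y
      pointwise {x} {y} x∉ y∉ rewrite x∉ | y∉ with adjacent i j x y
      ... | false = s≤s z≤n
      ... | true with weight i x j y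
      ...   | zero  = s≤s z≤n
      ...   | suc _ = s≤s z≤n
      rearrange : ∀ a b c d → a + (b + c) + d ≡ a + c + (b + d)
      rearrange a b c d = trans (+-assoc a (b + c) d) (trans
        (cong (a +_) (trans (cong (_+ d) (+-comm b c)) (+-assoc c b d))) (sym (+-assoc a c (b + d))))
      all : nonedges + length (edges G i j) ≡ n * n
      all = trans (cong (nonedges +_) (length-filter-cartesianProduct _ (allFin n) (allFin n)))
        (trans (sym (∑-+ (allFin n) _ _))
        (trans (∑-cong (allFin n) λ x → trans (sym (∑-+ (allFin n) _ _))
                 (trans (∑-cong (allFin n) λ y → 𝟙-not (adjacent i j x y)) (∑-allFin-1 n)))
        (trans (∑-const (allFin n) n) (cong (_* n) (length-tabulate {n = n} id)))))

    not-maximal : ∀ {K e} → 5 * K + 7 ≤ n →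
      0ℤ ℤ.< ℤ.+ e ℤ.* ℤ.+ e ℤ.+ ℤ.+ n ℤ.* (ℤ.+ n ℤ.- ℤ.+ K) ℤ.* ℤ.+ e
             ℤ.- ℤ.+ n ℤ.* ℤ.+ n ℤ.* (ℤ.+ n ℤ.* ℤ.+ n) →
      0ℤ ℤ.≤ ℤ.+ n ℤ.* (ℤ.+ n ℤ.- ℤ.+ K) ℤ.- ℤ.+ e →
      e ≤ length (edges G 0F 1F) → e ≤ length (edges G 0F 2F) → e ≤ length (edges G 1F 2F) →
      total S + m ≤ K → ⊥
    not-maximal {K} {e} n≥ dense cap e₀₁ e₀₂ e₁₂ small =
      some-density-small (kept 0F 1F) (kept 0F 2F) (kept 1F 2F) kept-triangle-free
        (part S 0F) (part S 1F) (part S 2F)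
        (proj₁ conditions) (proj₁ (proj₂ conditions)) (proj₂ (proj₂ conditions))
      where
      conditions = density-conditions-ℕ n K e
        (length (part S 0F)) (length (part S 1F)) (length (part S 2F))
        (count S 0F) (count S 1F) (count S 2F) m ordinaries specials centres
        (keptCount 0F 1F) (keptCount 0F 2F) (keptCount 1F 2F)
        n≥ dense cap (length-part S 0F) (length-part S 1F) (length-part S 2F) small
        ordinaries+specials specials+centres
        (keptCount-≥ 0F 1F e₀₁) (keptCount-≥ 0F 2F e₀₂) (keptCount-≥ 1F 2F e₁₂)

  -- Induction on the size of the packing

  module _ {K e} (n≥ : 5 * K + 7 ≤ n)
    (dense : 0ℤ ℤ.< ℤ.+ e ℤ.* ℤ.+ e ℤ.+ ℤ.+ n ℤ.* (ℤ.+ n ℤ.- ℤ.+ K) ℤ.* ℤ.+ e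
                    ℤ.- ℤ.+ n ℤ.* ℤ.+ n ℤ.* (ℤ.+ n ℤ.* ℤ.+ n))
    (cap : 0ℤ ℤ.≤ ℤ.+ n ℤ.* (ℤ.+ n ℤ.- ℤ.+ K) ℤ.- ℤ.+ e)
    (e₀₁ : e ≤ length (edges G 0F 1F)) (e₀₂ : e ≤ length (edges G 0F 2F))
    (e₁₂ : e ≤ length (edges G 1F 2F)) where

    packing : ∀ m S → total S + m ≤ K → Packing S (suc m)
    packing-from : ∀ m S → total S + m ≤ K → Packing S m → (∀ i x → Packing (insert S i x) m) →
                   Dec (Packing S (suc m)) → Packing S (suc m)

    packing zero S small = packing-from zero S small empty (λ _ _ → empty) (packing? 1 S)
    packing (suc m) S small = packing-from (suc m) S small
      -- The packing to be extended needs to avoid only `S`, so an arbitrary further vertex is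
      -- forbidden and then released.
      (weaken (λ i x → ∨-conicalˡ _ _) (smaller 0F (fromℕ< 0<n)))
      smaller (packing? (suc (suc m)) S)
      where
      0<n : 0 < n
      0<n = ≤-trans (s≤s z≤n) (≤-trans (m≤n+m 7 (5 * K)) n≥)
      smaller : ∀ i x → Packing (insert S i x) (suc m)
      smaller i x = packing m (insert S i x)
        (≤-trans (+-monoˡ-≤ m (total-insert S i x)) (≤-trans (≤-reflexive (sym (+-suc (total S) m))) small))

    packing-from m S small P Q (yes R) = R
    packing-from m S small P Q (no maximal) = ⊥-elim
      (not-maximal maximal P (classify maximal P) Q n≥ dense cap e₀₁ e₀₂ e₁₂ small)

  module _ {K} (n≥ : 5 * K + 7 ≤ n) {e} (dense : 0ℤ ℤ.< ℤ.+ e ℤ.* ℤ.+ e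
             ℤ.+ ℤ.+ n ℤ.* (ℤ.+ n ℤ.- ℤ.+ K) ℤ.* ℤ.+ e ℤ.- ℤ.+ n ℤ.* ℤ.+ n ℤ.* (ℤ.+ n ℤ.* ℤ.+ n))
    (e₀₁ : e ≤ length (edges G 0F 1F)) (e₀₂ : e ≤ length (edges G 0F 2F))
    (e₁₂ : e ≤ length (edges G 1F 2F)) where

    private
      -- The empty forbidden set: every vertex is available.
      everything : Region
      everything _ _ = false

      total-everything : total everything + K ≤ K
      total-everything = ≤-reflexive (cong (_+ K) (cong₂ _+_ (cong₂ _+_ zero′ zero′) zero′))
        where
        zero′ : ∑ (allFin n) (λ _ → 0) ≡ 0
        zero′ = trans (∑-const (allFin n) 0) (*-zeroʳ (length (allFin n)))

      limit : ℕ
      limit = n * (n ∸ K)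

      K≤n : K ≤ n
      K≤n = ≤-trans (≤-trans (m≤n*m K 5) (m≤m+n (5 * K) 7)) n≥

      +limit : ℤ.+ limit ≡ ℤ.+ n ℤ.* (ℤ.+ n ℤ.- ℤ.+ K)
      +limit = trans (ℤ.pos-* n (n ∸ K)) (cong (λ z → ℤ.+ n ℤ.* z) (pos-∸ {n} {K} K≤n))

      below : ∀ {f} → f ≤ limit → 0ℤ ℤ.≤ ℤ.+ n ℤ.* (ℤ.+ n ℤ.- ℤ.+ K) ℤ.- ℤ.+ f
      below {f} f≤ = subst (λ z → 0ℤ ℤ.≤ z ℤ.- ℤ.+ f) +limit (ℤ.i≤j⇒0≤j-i (+≤+ f≤))

      dense-limit : 0ℤ ℤ.< ℤ.+ limit ℤ.* ℤ.+ limit ℤ.+ ℤ.+ n ℤ.* (ℤ.+ n ℤ.- ℤ.+ K) ℤ.* ℤ.+ limit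
                           ℤ.- ℤ.+ n ℤ.* ℤ.+ n ℤ.* (ℤ.+ n ℤ.* ℤ.+ n)
      dense-limit = subst (λ z → 0ℤ ℤ.< z ℤ.* z ℤ.+ ℤ.+ n ℤ.* (ℤ.+ n ℤ.- ℤ.+ K) ℤ.* z
                                       ℤ.- ℤ.+ n ℤ.* ℤ.+ n ℤ.* (ℤ.+ n ℤ.* ℤ.+ n)) (sym +limit)
        (dense-cap (ℤ.+ n) (ℤ.+ K) (+≤+ z≤n)
          (0≤-by (ℤ.i≤j⇒0≤j-i (+≤+ n≥)) (cong (λ z → ℤ.+ n ℤ.- (z ℤ.+ ℤ.+ 7)) (ℤ.pos-* 5 K))))

    -- The density bounds need an edge count of at most n (n - K); a larger one is lowered to that.
    large-packing : Packing (λ _ _ → false) (suc K)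
    large-packing with e ≤? limit
    ... | yes e≤ = packing n≥ dense (below e≤) e₀₁ e₀₂ e₁₂ K everything total-everything
    ... | no  e≰ = packing n≥ dense-limit (below ≤-refl) (lower e₀₁) (lower e₀₂) (lower e₁₂)
                     K everything total-everything
      where
      lower : ∀ {f} → e ≤ f → limit ≤ f
      lower = ≤-trans (<⇒≤ (≰⇒> e≰))

  packing⇒disjoint : ∀ {S k} → Packing S k → HasDisjointTriangles G k
  packing⇒disjoint P = T , λ s s′ s≢s′ v v∈s v∈s′ → s≢s′ (injective P (proj₁ v)
      (trans (sym (coordinate s v v∈s)) (coordinate s′ v v∈s′)))
    where
    T : _ → Triangle G
    T s = record
      { a = 0F , member P s 0F ; b = 1F , member P s 1F ; c = 2F , member P s 2F
      ; ab = triangle P s 0F 1F (λ ()) ; bc = triangle P s 1F 2F (λ ()) ; ac = triangle P s 0F 2F (λ ())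
      }
    coordinate : ∀ s v → _∈△_ G v (T s) → proj₂ v ≡ member P s (proj₁ v)
    coordinate s _ (inj₁ refl)        = refl
    coordinate s _ (inj₂ (inj₁ refl)) = refl
    coordinate s _ (inj₂ (inj₂ refl)) = refl

corollary1p4 : (n k : ℕ) → 2 ≤ k → (5k+2≤n : 5 * k + 2 ≤ n) →
    (G : TripartiteGraph (λ _ → n)) →
    (τ : ℝ) → Isτ k n τ →
    τ <ℝ fromℚ (density G {{5k+2≤n⇒nonZero k 5k+2≤n}}) →
    HasDisjointTriangles G k
corollary1p4 n (suc K) _ 5k+2≤n G τ isτ τ<d =
  packing⇒disjoint (large-packing n≥
    (density>τ⇒dense G {{5k+2≤n⇒nonZero (suc K) 5k+2≤n}} K k≤n τ isτ τ<d)
    (≤-trans (m⊓n≤m (size 0F 1F ⊓ size 0F 2F) (size 1F 2F)) (m⊓n≤m (size 0F 1F) (size 0F 2F)))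
    (≤-trans (m⊓n≤m (size 0F 1F ⊓ size 0F 2F) (size 1F 2F)) (m⊓n≤n (size 0F 1F) (size 0F 2F)))
    (m⊓n≤n (size 0F 1F ⊓ size 0F 2F) (size 1F 2F)))
  where
  open Counting G
  open RationalQuadratic
  size : Fin 3 → Fin 3 → ℕ
  size i j = length (edges G i j)
  n≥ : 5 * K + 7 ≤ n
  n≥ = subst (_≤ n) (trans (cong (_+ 2) (trans (*-suc 5 K) (+-comm 5 (5 * K)))) (+-assoc (5 * K) 5 2)) 5k+2≤n
  k≤n : suc K ≤ n
  k≤n = ≤-trans (≤-trans (m≤n*m (suc K) 5) (m≤m+n (5 * suc K) 2)) 5k+2≤n
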